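{- Let $p\geq5$ be prime, $2\leq b\leq p$, $1\leq c\leq p-1$, $s=b+c(p-1)$, $r=s+p^t(p-1)d$ with integers $t\geq2$, $d\geq1$, $p\nmid d$, and let $m$ be an integer with $1\leq m\leq c-1-\epsilon$. Let $A=(\alpha(i,l))_{1\leq i\leq m+1,\,0\leq l\leq m}$ (defined in the context). Suppose one of the following holds: (1) $b\geq c+1$ and $m\in[1,b-c]$; (2) $b\geq c$ and $m\in[1,\frac{b-1}{2}]\cap[b-c+1,c-1-\epsilon]$; (3) $2\leq b\leq c-1$ and $m\in\left([1,\frac{b-1}{2}]\cup[b,c-2]\right)\cap[1,p+b-c]$; (4) $2\leq b\leq 2c-3-p$ and $m\in[p+b-c+1,\frac{p+b-2}{2}]\cap[p+b-c+1,c-3]$. Then for every $1\leq i\leq m$ the linear system $AX\equiv e_i\pmod p$ has a solution $X\in\mathbb{Z}_p^{m+1}$, where $e_i$ is the $i$-th standard basis vector.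
   Context: Intervals denote sets of integers. Binomial convention: for $n\in\mathbb{Z}_{\geq0}$, $\binom nk=0$ if $k<0$ or $k>n$. $\epsilon$: $0$ if $2c-1\leq b\leq p$; $1$ if $2(c-1)-p\leq b\leq 2(c-1)$; $2$ if $2\leq b\leq 2(c-1)-(p+1)$. $\epsilon_1$: $0$ if $2m+1\leq b\leq p$; $1$ if $2m+1-(p-1)\leq b\leq 2m$; $2$ if $2\leq b\leq 2m-(p-1)$. $\beta(a,i)$ ($a\geq1$, $1\leq i\leq m+1$): $\beta(1,i)=\binom{m+1}{i}$, $\beta(a,i)=\sum_{l=1}^{a-1}(-1)^{l+1}\binom{m+1}{l}\beta(a-l,i)+(-1)^{a-1}\binom{m+1}{i+a-1}$ for $a\geq2$. For $0\leq l\leq p-1$, $1\leq i\leq m+1$: $\alpha_1(i,l)=(-1)^{i+1}\sum_{a=1}^{c-m-\epsilon_1}\binom{r-l}{b-m+(c-m-a)(p-1)}\beta(a,i)$, and $\alpha(i,l)=\alpha_1(i,l)+\binom{r-l}{b-m+(i+c-m-1)(p-1)}$ if $1\leq i\leq m$, $\alpha(m+1,l)=\alpha_1(m+1,l)$. -}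

module Defs where

open import Data.Nat as ℕ using (ℕ; zero; suc; _∸_; _≤?_)
open import Data.Nat.Combinatorics using (_C_)
open import Data.Integer as ℤ using (ℤ; +_; -[1+_]; -_)
open import Data.Fin using (Fin; toℕ)
import Data.Fin as F
open import Relation.Nullary.Decidable using (does)
open import Data.Bool using (if_then_else_)

neg1^ : ℕ → ℤ
neg1^ zero = + 1
neg1^ (suc k) = - neg1^ k

binom : ℕ → ℤ → ℤ
binom n (+ k) = + (n C k)
binom n -[1+ _ ] = + 0

Σ< : ℕ → (ℕ → ℤ) → ℤ
Σ< zero f = + 0
Σ< (suc n) f = Σ< n f ℤ.+ f n

ΣFin : (n : ℕ) → (Fin n → ℤ) → ℤ
ΣFin zero f = + 0
ΣFin (suc n) f = f F.zero ℤ.+ ΣFin n (λ j → f (F.suc j))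

ε : (p b c : ℕ) → ℕ
ε p b c =
  if does (2 ℕ.* c ≤? b ℕ.+ 1) then 0
  else if does (2 ℕ.* (c ∸ 1) ≤? b ℕ.+ p) then 1
  else 2

ε₁ : (p b m : ℕ) → ℕ
ε₁ p b m =
  if does (2 ℕ.* m ℕ.+ 1 ≤? b) then 0
  else if does (2 ℕ.* m ℕ.+ 1 ≤? b ℕ.+ (p ∸ 1)) then 1
  else 2

-- β(a,i) for fixed m:
--   β(a,i) = Σ_{l=1}^{a-1} (-1)^{l+1} C(m+1,l) β(a-l,i) + (-1)^{a-1} C(m+1,i+a-1)
-- (for a = 1 the sum is empty, giving β(1,i) = C(m+1,i)).
-- β m i (suc n) is β(n+1,i); βS m i n k is the partial sum over l = n-k+1 .. n
-- (i.e. a-l = 1 .. k) of the sum above for a = n+1.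
mutual
  β : (m i a : ℕ) → ℤ
  β m i zero = + 0   -- unused (a ≥ 1)
  β m i (suc n) = βS m i n n ℤ.+ neg1^ n ℤ.* (+ (suc m C (i ℕ.+ n)))

  βS : (m i n k : ℕ) → ℤ
  βS m i n zero = + 0
  βS m i n (suc k) =
    βS m i n k ℤ.+ neg1^ (suc (n ∸ k)) ℤ.* (+ (suc m C (n ∸ k))) ℤ.* β m i (suc k)

_⊖'_ : ℕ → ℕ → ℤ
x ⊖' y = + x ℤ.- + y

α₁ : (p b c r m i l : ℕ) → ℤ
α₁ p b c r m i l =
  neg1^ (suc i) ℤ.*
  Σ< (c ∸ m ∸ ε₁ p b m)
     (λ a' → let a = suc a' in
        binom (r ∸ l) ((b ⊖' m) ℤ.+ ((c ⊖' m) ℤ.- + a) ℤ.* (+ (p ∸ 1)))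
        ℤ.* β m i a)

α : (p b c r m i l : ℕ) → ℤ
α p b c r m i l =
  if does (i ≤? m)
  then α₁ p b c r m i l ℤ.+
       binom (r ∸ l) ((b ⊖' m) ℤ.+ ((+ (i ℕ.+ c) ℤ.- + m) ℤ.- + 1) ℤ.* (+ (p ∸ 1)))
  else α₁ p b c r m i l

AX : (p b c r m : ℕ) → (Fin (suc m) → ℤ) → Fin (suc m) → ℤ
AX p b c r m X j = ΣFin (suc m) (λ l → α p b c r m (suc (toℕ j)) (toℕ l) ℤ.* X l)

e : (m i : ℕ) → Fin (suc m) → ℤ
e m i j = if does (suc (toℕ j) ℕ.≟ i) then + 1 else + 0

{-# OPTIONS --safe #-}
-- Write q = p - 1 and n = c - j.  Up to sign, the β(a,i) continue beyond m the values of the polynomial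
-- g of degree ≤ m in n that interpolates a Kronecker delta on [0,m]; hence
-- α(i,l) = Σ_{1≤n≤c′} g(n) C(r-l, M-nq) with M = s-m and c′ = c-ε₁.
-- By Pascal's rule the columns span all the vectors with entries Σ_{n≥1} g(n) C(r-m, M-v-nq), 0 ≤ v ≤ m, and
-- modulo p the binomial coefficient here is C(M, v+nq).  Writing M = N + c′q with m < N ≤ q,
-- one has for v ≥ 1
--     Σ_n g(n) C(M, v+nq) ≡ Σ_n g(n) C(M, v-n) C(c′,n)  (mod p),
-- because (1+x)^(K+p) ≡ (1+x)^K (1+x^p) makes both sides obey the same recurrence in c′, each step of which
-- lowers the degree of g by one and N by at most one.  The terms n = 0 agree and can be dropped, so the
-- vectors are triangular in the values g(1), …, g(m), with diagonal entries C(c′,v) prime to p;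
-- the e_i are these vectors of values.  Hypotheses (1)-(4) only serve to give ε₁ = 0, 2m < b
-- (N = b - m, c′ = c) or ε₁ = 1, b ≤ m, 2m+2 ≤ p+b (N = b - m + q, c′ = c - 1).
module Submission where

open import Defs
open import Data.Bool using (if_then_else_)
open import Data.Empty using (⊥-elim)
open import Data.Fin as F using (Fin; toℕ; fromℕ<)
import Data.Fin.Properties as Fₚ
open import Data.Integer using (ℤ; +_; -[1+_]; _+_; _*_; _-_; -_; 0ℤ; 1ℤ; ∣_∣)
open import Data.Integer.Divisibility using (_∣_)
import Data.Integer.Properties as ℤₚ
open import Data.Integer.Tactic.RingSolver using (solve-∀)
open import Data.Nat as ℕ using (ℕ; zero; suc; _∸_; _≤_; _<_; _^_; s≤s; z≤n)
open import Data.Nat.Combinatorics using (_C_; nC1≡n; nCn≡1; nCk≡nC[n∸k]; nCk+nC[k+1]≡[n+1]C[k+1]; k>n⇒nCk≡0)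
open import Data.Nat.Coprimality using (Coprime; coprime-Bézout)
import Data.Nat.Divisibility as ND
open import Data.Nat.GCD using (module Bézout)
open import Data.Nat.Primality using (Prime; euclidsLemma; prime⇒irreducible; ¬prime[1])
import Data.Nat.Properties as ℕₚ
open import Data.Nat.Tactic.RingSolver using () renaming (solve-∀ to ℕ-solve-∀)
open import Data.Product using (∃; _,_; _×_; proj₁; proj₂)
open import Data.Sum using (_⊎_; inj₁; inj₂)
open import Relation.Binary.Bundles using (Setoid)
open import Relation.Binary.PropositionalEquality
import Relation.Binary.Reasoning.Setoid as SetoidReasoning
open import Relation.Nullary using (¬_; yes; no)
open import Relation.Nullary.Decidable using (does; dec-true; dec-false)

-- Finite sums, binomial coefficients and differences

Σ<-cong : ∀ n {f g : ℕ → ℤ} → (∀ k → k < n → f k ≡ g k) → Σ< n f ≡ Σ< n g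
Σ<-cong zero    h = refl
Σ<-cong (suc n) h = cong₂ _+_ (Σ<-cong n (λ k k<n → h k (ℕₚ.m<n⇒m<1+n k<n))) (h n ℕₚ.≤-refl)

Σ<-zero : ∀ n {f : ℕ → ℤ} → (∀ k → k < n → f k ≡ 0ℤ) → Σ< n f ≡ 0ℤ
Σ<-zero zero    h = refl
Σ<-zero (suc n) h = cong₂ _+_ (Σ<-zero n (λ k k<n → h k (ℕₚ.m<n⇒m<1+n k<n))) (h n ℕₚ.≤-refl)

Σ<-+ : ∀ n (f g : ℕ → ℤ) → Σ< n (λ k → f k + g k) ≡ Σ< n f + Σ< n g
Σ<-+ zero    f g = refl
Σ<-+ (suc n) f g = trans (cong (_+ (f n + g n)) (Σ<-+ n f g)) (shuffle (Σ< n f) (Σ< n g) (f n) (g n))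
  where
  shuffle : ∀ a b c d → a + b + (c + d) ≡ a + c + (b + d)
  shuffle = solve-∀

Σ<-*ˡ : ∀ n a (f : ℕ → ℤ) → Σ< n (λ k → a * f k) ≡ a * Σ< n f
Σ<-*ˡ zero    a f = sym (ℤₚ.*-zeroʳ a)
Σ<-*ˡ (suc n) a f = trans (cong (_+ a * f n) (Σ<-*ˡ n a f)) (sym (ℤₚ.*-distribˡ-+ a (Σ< n f) (f n)))

Σ<-split : ∀ m n (f : ℕ → ℤ) → Σ< (m ℕ.+ n) f ≡ Σ< m f + Σ< n (λ k → f (m ℕ.+ k))
Σ<-split m zero    f = trans (cong (λ x → Σ< x f) (ℕₚ.+-identityʳ m)) (sym (ℤₚ.+-identityʳ _))
Σ<-split m (suc n) f = begin
  Σ< (m ℕ.+ suc n) f                                      ≡⟨ cong (λ x → Σ< x f) (ℕₚ.+-suc m n) ⟩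
  Σ< (m ℕ.+ n) f + f (m ℕ.+ n)                            ≡⟨ cong (_+ f (m ℕ.+ n)) (Σ<-split m n f) ⟩
  Σ< m f + Σ< n (λ k → f (m ℕ.+ k)) + f (m ℕ.+ n)         ≡⟨ ℤₚ.+-assoc (Σ< m f) _ _ ⟩
  Σ< m f + (Σ< n (λ k → f (m ℕ.+ k)) + f (m ℕ.+ n))       ∎
  where open ≡-Reasoning

Σ<-head : ∀ n (f : ℕ → ℤ) → Σ< (suc n) f ≡ f 0 + Σ< n (λ k → f (suc k))
Σ<-head n f = trans (Σ<-split 1 n f) (cong (_+ Σ< n (λ k → f (suc k))) (ℤₚ.+-identityˡ (f 0)))

Σ<-single : ∀ n k {f : ℕ → ℤ} → k < n → (∀ j → j < n → j ≢ k → f j ≡ 0ℤ) → Σ< n f ≡ f k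
Σ<-single (suc n) k {f} k<1+n h with k ℕ.≟ n
... | yes refl = trans (cong (_+ f n) (Σ<-zero n (λ j j<n → h j (ℕₚ.m<n⇒m<1+n j<n) (ℕₚ.<⇒≢ j<n)))) (ℤₚ.+-identityˡ (f n))
... | no k≢n   = trans (cong₂ _+_ (Σ<-single n k (ℕₚ.≤∧≢⇒< (ℕ.s≤s⁻¹ k<1+n) k≢n) (λ j j<n → h j (ℕₚ.m<n⇒m<1+n j<n)))
                              (h n ℕₚ.≤-refl (λ n≡k → k≢n (sym n≡k))))
                       (ℤₚ.+-identityʳ (f k))

binom-pascal : ∀ n k → binom (suc n) k ≡ binom n k + binom n (k - 1ℤ)
binom-pascal n (+ zero)   = refl
binom-pascal n (+ suc k)  = cong +_ (trans (sym (nCk+nC[k+1]≡[n+1]C[k+1] n k)) (ℕₚ.+-comm (n C k) (n C suc k)))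
binom-pascal n -[1+ k ]   = refl

-- The witness `a` encodes k < 0 as an equation, so that side conditions become ring identities over
-- ℤ; `binom-big` encodes k > n in the same way.
binom-neg : ∀ n k a → k + + suc a ≡ 0ℤ → binom n k ≡ 0ℤ
binom-neg n -[1+ k ] a h = refl
binom-neg n (+ k) a h with () ← trans (sym (ℕₚ.+-suc k a)) (ℤₚ.+-injective h)

C-big : ∀ n a → n C (n ℕ.+ suc a) ≡ 0
C-big n a = k>n⇒nCk≡0 (ℕₚ.m<m+n n (s≤s z≤n))

binom-big : ∀ n k a → k ≡ + n + + suc a → binom n k ≡ 0ℤ
binom-big n _ a refl = cong +_ (C-big n a)

-- Both sides vanish outside [0,n], so the symmetry extends to every integer `k`.
binom-sym : ∀ n k → binom n (+ n - k) ≡ binom n k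
binom-sym n -[1+ k ] = cong +_ (C-big n k)
binom-sym n (+ k) with k ℕ.≤? n
... | yes k≤n rewrite ℤₚ.m-n≡m⊖n n k | ℤₚ.⊖-≥ k≤n = cong +_ (sym (nCk≡nC[n∸k] k≤n))
... | no k≰n = trans (binom-neg n (+ n - + k) (k ∸ suc n) eq) (cong +_ (sym (k>n⇒nCk≡0 n<k)))
  where
  n<k = ℕₚ.≰⇒> k≰n
  cancel : ∀ x y z → x - y + z ≡ x + z - y
  cancel = solve-∀
  eq : + n - + k + + suc (k ∸ suc n) ≡ 0ℤ
  eq = trans (cancel (+ n) (+ k) (+ suc (k ∸ suc n)))
         (trans (cong (λ x → + x - + k) (trans (ℕₚ.+-suc n (k ∸ suc n)) (ℕₚ.m+[n∸m]≡n n<k))) (ℤₚ.+-inverseʳ (+ k)))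

-- This is (1 + T)ⁿ⁺¹ = (1 + T)ⁿ(1 + T) for the shift T, applied to `φ` and evaluated at 0.
Σ<-pascal : ∀ n (φ : ℕ → ℤ) →
  Σ< (2 ℕ.+ n) (λ k → + (suc n C k) * φ k) ≡ Σ< (suc n) (λ k → + (n C k) * (φ k + φ (suc k)))
Σ<-pascal n φ = begin
  Σ< (2 ℕ.+ n) (λ k → + (suc n C k) * φ k)
    ≡⟨ Σ<-cong (2 ℕ.+ n) (λ k _ → trans (cong (_* φ k) (binom-pascal n (+ k))) (ℤₚ.*-distribʳ-+ (φ k) (+ (n C k)) (binom n (+ k - 1ℤ)))) ⟩
  Σ< (2 ℕ.+ n) (λ k → + (n C k) * φ k + binom n (+ k - 1ℤ) * φ k)
    ≡⟨ Σ<-+ (2 ℕ.+ n) _ _ ⟩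
  Σ< (suc n) (λ k → + (n C k) * φ k) + + (n C suc n) * φ (suc n) + Σ< (2 ℕ.+ n) (λ k → binom n (+ k - 1ℤ) * φ k)
    ≡⟨ cong₂ _+_ (cong (λ x → Σ< (suc n) (λ k → + (n C k) * φ k) + + x * φ (suc n)) (k>n⇒nCk≡0 (ℕₚ.n<1+n n)))
                 (Σ<-head (suc n) _) ⟩
  Σ< (suc n) (λ k → + (n C k) * φ k) + 0ℤ * φ (suc n)
    + (0ℤ * φ 0 + Σ< (suc n) (λ k → + (n C k) * φ (suc k)))
    ≡⟨ drop-zeros (Σ< (suc n) (λ k → + (n C k) * φ k)) (φ (suc n)) (φ 0) _ ⟩
  Σ< (suc n) (λ k → + (n C k) * φ k) + Σ< (suc n) (λ k → + (n C k) * φ (suc k))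
    ≡⟨ Σ<-+ (suc n) _ _ ⟨
  Σ< (suc n) (λ k → + (n C k) * φ k + + (n C k) * φ (suc k))
    ≡⟨ Σ<-cong (suc n) (λ k _ → ℤₚ.*-distribˡ-+ (+ (n C k)) (φ k) (φ (suc k))) ⟨
  Σ< (suc n) (λ k → + (n C k) * (φ k + φ (suc k))) ∎
  where
  open ≡-Reasoning
  drop-zeros : ∀ a b c d → a + 0ℤ * b + (0ℤ * c + d) ≡ a + d
  drop-zeros = solve-∀

Δ : (ℕ → ℤ) → ℕ → ℤ
Δ g n = g (suc n) - g n

-- Identical vanishing of `Δ^ N g` expresses degree < N. Since `Δ` is applied first, this condition
-- for `g` and N+1 is by definition the one for `Δ g` and N.
Δ^ : ℕ → (ℕ → ℤ) → ℕ → ℤ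
Δ^ zero    g = g
Δ^ (suc N) g = Δ^ N (Δ g)

Δ^-suc : ∀ N g n → Δ^ (suc N) g n ≡ Δ^ N g (suc n) - Δ^ N g n
Δ^-suc zero    g n = refl
Δ^-suc (suc N) g n = Δ^-suc N (Δ g) n

-- The coefficient of xᵏ in (1 - x)ᴺ.
altBinom : ℕ → ℕ → ℤ
altBinom N k = neg1^ k * + (N C k)

-- The coefficient of xᶻ in (1 - x)ᴺ Σₙ g(n) xⁿ.
Δconv : ℕ → (ℕ → ℤ) → ℕ → ℤ
Δconv N g z = Σ< (suc z) (λ x → altBinom N (z ∸ x) * g x)

-- One more factor 1 - x subtracts the preceding coefficient; termwise this is Pascal's rule.
Δconv-suc : ∀ N g z → Δconv (suc N) g (suc z) ≡ Δconv N g (suc z) - Δconv N g z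
Δconv-suc N g z = begin
  Σ< (suc z) (λ x → altBinom (suc N) (suc z ∸ x) * g x) + altBinom (suc N) (z ∸ z) * g (suc z)
    ≡⟨ cong₂ _+_ (Σ<-cong (suc z) step) (cong (λ y → neg1^ y * + (suc N C y) * g (suc z)) (ℕₚ.n∸n≡0 z)) ⟩
  Σ< (suc z) (λ x → altBinom N (suc z ∸ x) * g x + - 1ℤ * (altBinom N (z ∸ x) * g x)) + altBinom N 0 * g (suc z)
    ≡⟨ cong₂ _+_ (trans (Σ<-+ (suc z) (λ x → altBinom N (suc z ∸ x) * g x) (λ x → - 1ℤ * (altBinom N (z ∸ x) * g x)))
                        (cong (λ y → Σ< (suc z) (λ x → altBinom N (suc z ∸ x) * g x) + y)
                              (Σ<-*ˡ (suc z) (- 1ℤ) (λ x → altBinom N (z ∸ x) * g x))))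
                 (cong (λ y → altBinom N y * g (suc z)) (sym (ℕₚ.n∸n≡0 z))) ⟩
  Σ< (suc z) (λ x → altBinom N (suc z ∸ x) * g x) + - 1ℤ * Δconv N g z + altBinom N (z ∸ z) * g (suc z)
    ≡⟨ reorder (Σ< (suc z) (λ x → altBinom N (suc z ∸ x) * g x)) (Δconv N g z) (altBinom N (z ∸ z) * g (suc z)) ⟩
  Δconv N g (suc z) - Δconv N g z ∎
  where
  open ≡-Reasoning
  reorder : ∀ a b c → a + - 1ℤ * b + c ≡ a + c - b
  reorder = solve-∀
  expand : ∀ s a b y → - s * (a + b) * y ≡ - s * b * y + - 1ℤ * (s * a * y)
  expand = solve-∀
  step : ∀ x → x < suc z →
    altBinom (suc N) (suc z ∸ x) * g x ≡ altBinom N (suc z ∸ x) * g x + - 1ℤ * (altBinom N (z ∸ x) * g x)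
  step x x<1+z rewrite ℕₚ.+-∸-assoc 1 (ℕ.s≤s⁻¹ x<1+z) =
    trans (cong (λ y → - neg1^ (z ∸ x) * + y * g x) (sym (nCk+nC[k+1]≡[n+1]C[k+1] N (z ∸ x))))
          (expand (neg1^ (z ∸ x)) (+ (N C (z ∸ x))) (+ (N C suc (z ∸ x))) (g x))

-- Both sides obey the same recurrence in N (`Δ^-suc`, `Δconv-suc`). Differences of a recursively
-- given sequence can thus be read off its generating function.
Δ^≡Δconv : ∀ N g n → Δ^ N g n ≡ Δconv N g (n ℕ.+ N)
Δ^≡Δconv zero g n rewrite ℕₚ.+-identityʳ n = sym (trans (Σ<-single (suc n) n (ℕₚ.≤-refl) other) self)
  where
  vanish : ∀ k x → k ≢ 0 → altBinom 0 k * x ≡ 0ℤ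
  vanish zero    x k≢0 = ⊥-elim (k≢0 refl)
  vanish (suc k) x _   = cong (_* x) (ℤₚ.*-zeroʳ (neg1^ (suc k)))
  other : ∀ j → j < suc n → j ≢ n → altBinom 0 (n ∸ j) * g j ≡ 0ℤ
  other j j<1+n j≢n = vanish (n ∸ j) (g j) (λ n∸j≡0 → j≢n (ℕₚ.≤-antisym (ℕ.s≤s⁻¹ j<1+n) (ℕₚ.m∸n≡0⇒m≤n n∸j≡0)))
  self : altBinom 0 (n ∸ n) * g n ≡ g n
  self rewrite ℕₚ.n∸n≡0 n = ℤₚ.*-identityˡ (g n)
Δ^≡Δconv (suc N) g n = begin
  Δ^ (suc N) g n                                    ≡⟨ Δ^-suc N g n ⟩
  Δ^ N g (suc n) - Δ^ N g n                         ≡⟨ cong₂ _-_ (Δ^≡Δconv N g (suc n)) (Δ^≡Δconv N g n) ⟩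
  Δconv N g (suc (n ℕ.+ N)) - Δconv N g (n ℕ.+ N)   ≡⟨ Δconv-suc N g (n ℕ.+ N) ⟨
  Δconv (suc N) g (suc (n ℕ.+ N))                   ≡⟨ cong (Δconv (suc N) g) (ℕₚ.+-suc n N) ⟨
  Δconv (suc N) g (n ℕ.+ suc N)                     ∎
  where open ≡-Reasoning

-- Congruences modulo p

-- Induction by Pascal's rule. Both divisibility lemmas that follow rest on this identity.
absorption : ∀ n k → suc k ℕ.* (suc n C suc k) ≡ suc n ℕ.* (n C k)
absorption n       zero    = trans (cong (1 ℕ.*_) (nC1≡n (suc n))) (ℕₚ.*-comm 1 (suc n))
absorption zero    (suc k) = ℕₚ.*-zeroʳ (2 ℕ.+ k)
absorption (suc n) (suc k) = begin
  (2 ℕ.+ k) ℕ.* ((2 ℕ.+ n) C (2 ℕ.+ k))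
    ≡⟨ cong ((2 ℕ.+ k) ℕ.*_) (nCk+nC[k+1]≡[n+1]C[k+1] (suc n) (suc k)) ⟨
  (2 ℕ.+ k) ℕ.* (x ℕ.+ (suc n C (2 ℕ.+ k)))
    ≡⟨ expand k x (suc n C (2 ℕ.+ k)) ⟩
  x ℕ.+ (suc k ℕ.* x ℕ.+ (2 ℕ.+ k) ℕ.* (suc n C (2 ℕ.+ k)))
    ≡⟨ cong (x ℕ.+_) (cong₂ ℕ._+_ (absorption n k) (absorption n (suc k))) ⟩
  x ℕ.+ (suc n ℕ.* (n C k) ℕ.+ suc n ℕ.* (n C suc k))
    ≡⟨ cong (x ℕ.+_) (ℕₚ.*-distribˡ-+ (suc n) (n C k) (n C suc k)) ⟨
  x ℕ.+ suc n ℕ.* (n C k ℕ.+ n C suc k)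
    ≡⟨ cong (λ y → x ℕ.+ suc n ℕ.* y) (nCk+nC[k+1]≡[n+1]C[k+1] n k) ⟩
  (2 ℕ.+ n) ℕ.* x ∎
  where
  open ≡-Reasoning
  x = suc n C suc k
  expand : ∀ k x y → (2 ℕ.+ k) ℕ.* (x ℕ.+ y) ≡ x ℕ.+ (suc k ℕ.* x ℕ.+ (2 ℕ.+ k) ℕ.* y)
  expand = ℕ-solve-∀

-- By `absorption` p divides (k+1) C(p,k+1), and 0 < k+1 < p excludes the first factor.
prime∣C : ∀ {q k} → Prime (suc q) → k < q → suc q ND.∣ (suc q C suc k)
prime∣C {q} {k} pr k<q with euclidsLemma (suc k) (suc q C suc k) pr
                              (subst (suc q ND.∣_) (sym (absorption q k)) (ND.m∣m*n (q C k)))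
... | inj₁ p∣1+k = ⊥-elim (ℕₚ.<⇒≱ (s≤s k<q) (ND.∣⇒≤ p∣1+k))
... | inj₂ p∣C   = p∣C

-- Descent: by `absorption` a prime p dividing C(n+1,k+1) divides (n+1) C(n,k), hence C(n,k) because
-- n+1 < p; the descent ends at a coefficient equal to 1.
prime∤C : ∀ {p} n k → Prime p → n < p → k ≤ n → ¬ (p ND.∣ (n C k))
prime∤C n zero pr n<p k≤n p∣1 = ¬prime[1] (subst Prime (ND.∣1⇒≡1 p∣1) pr)
prime∤C {p} (suc n) (suc k) pr n<p (s≤s k≤n) p∣C
  with euclidsLemma (suc n) (n C k) pr (subst (p ND.∣_) (absorption n k) (ND.∣n⇒∣m*n (suc k) p∣C))
... | inj₁ p∣1+n = ℕₚ.<⇒≱ n<p (ND.∣⇒≤ p∣1+n)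
... | inj₂ p∣C′  = prime∤C n k pr (ℕₚ.<-trans (ℕₚ.n<1+n n) n<p) k≤n p∣C′

module Mod (p : ℕ) where

  infix 4 _≋_

  -- The quotient is kept as data, which turns the closure properties into ring identities; `≋⇒∣`
  -- returns to divisibility.
  record _≋_ (x y : ℤ) : Set where
    constructor quotient
    field
      quot : ℤ
      eq   : x ≡ y + quot * + p

  ≡⇒≋ : ∀ {x y} → x ≡ y → x ≋ y
  ≡⇒≋ {x} refl = quotient 0ℤ (sym (ℤₚ.+-identityʳ x))

  ≋-refl : ∀ {x} → x ≋ x
  ≋-refl = ≡⇒≋ refl

  ≋-sym : ∀ {x y} → x ≋ y → y ≋ x
  ≋-sym {y = y} (quotient k refl) = quotient (- k) (lemma y k (+ p))
    where
    lemma : ∀ y k p → y ≡ y + k * p + - k * p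
    lemma = solve-∀

  ≋-trans : ∀ {x y z} → x ≋ y → y ≋ z → x ≋ z
  ≋-trans {z = z} (quotient k refl) (quotient l refl) = quotient (l + k) (lemma z k l (+ p))
    where
    lemma : ∀ z k l p → z + l * p + k * p ≡ z + (l + k) * p
    lemma = solve-∀

  +-cong : ∀ {x y u v} → x ≋ y → u ≋ v → x + u ≋ y + v
  +-cong {y = y} {v = v} (quotient k refl) (quotient l refl) = quotient (k + l) (lemma y v k l (+ p))
    where
    lemma : ∀ y v k l p → y + k * p + (v + l * p) ≡ y + v + (k + l) * p
    lemma = solve-∀

  *-cong : ∀ {x y u v} → x ≋ y → u ≋ v → x * u ≋ y * v
  *-cong {y = y} {v = v} (quotient k refl) (quotient l refl) = quotient (y * l + k * v + k * l * + p) (lemma y v k l (+ p))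
    where
    lemma : ∀ y v k l p → (y + k * p) * (v + l * p) ≡ y * v + (y * l + k * v + k * l * p) * p
    lemma = solve-∀

  *-congˡ : ∀ a {x y} → x ≋ y → a * x ≋ a * y
  *-congˡ a = *-cong (≋-refl {a})

  *-congʳ : ∀ a {x y} → x ≋ y → x * a ≋ y * a
  *-congʳ a x≋y = *-cong x≋y (≋-refl {a})

  +-cancelˡ : ∀ a {x y} → a + x ≋ a + y → x ≋ y
  +-cancelˡ a {x} {y} h =
    ≋-trans (≡⇒≋ (undo a x)) (≋-trans (+-cong (≋-refl { - a}) h) (≡⇒≋ (sym (undo a y))))
    where
    undo : ∀ a x → x ≡ - a + (a + x)
    undo = solve-∀

  ≋-setoid : Setoid _ _
  ≋-setoid = record
    { Carrier = ℤ
    ; _≈_ = _≋_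
    ; isEquivalence = record { refl = ≋-refl ; sym = ≋-sym ; trans = ≋-trans } }

  module ≋-Reasoning = SetoidReasoning ≋-setoid

  Σ<-≋ : ∀ n {f g : ℕ → ℤ} → (∀ k → k < n → f k ≋ g k) → Σ< n f ≋ Σ< n g
  Σ<-≋ zero    h = ≋-refl
  Σ<-≋ (suc n) h = +-cong (Σ<-≋ n (λ k k<n → h k (ℕₚ.m<n⇒m<1+n k<n))) (h n ℕₚ.≤-refl)

  ∣⇒≋0 : ∀ {n} → p ND.∣ n → + n ≋ 0ℤ
  ∣⇒≋0 (ND.divides k eq) = quotient (+ k) (trans (cong +_ eq) (trans (ℤₚ.pos-* k p) (sym (ℤₚ.+-identityˡ _))))

  ≋⇒∣ : ∀ {x y} → x ≋ y → + p ∣ (x - y)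
  ≋⇒∣ {y = y} (quotient k refl) = ND.divides ∣ k ∣ (trans (cong ∣_∣ (cancel y (k * + p))) (ℤₚ.abs-* k (+ p)))
    where
    cancel : ∀ y z → y + z - y ≡ z
    cancel = solve-∀

  -- Bézout's identity for the coprime pair p, u; its two forms over ℕ decide the sign of the
  -- inverse.
  inverse : ∀ {u} → Prime p → ¬ (p ND.∣ u) → ∃ λ a → a * + u ≋ 1ℤ
  inverse {u} pr p∤u with coprime-Bézout cop
    where
    cop : Coprime p u
    cop (d∣p , d∣u) with prime⇒irreducible pr d∣p
    ... | inj₁ d≡1  = d≡1
    ... | inj₂ refl = ⊥-elim (p∤u d∣u)
  ... | Bézout.+- x y eq = - + y , quotient (- + x) (lemma (+ u) (+ y) (+ x) (+ p) (lift eq))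
    where
    lift : 1 ℕ.+ y ℕ.* u ≡ x ℕ.* p → 1ℤ + + y * + u ≡ + x * + p
    lift eq = trans (cong (λ z → 1ℤ + z) (sym (ℤₚ.pos-* y u))) (trans (cong +_ eq) (ℤₚ.pos-* x p))
    rearrange : ∀ w → - w ≡ 1ℤ + - (1ℤ + w)
    rearrange = solve-∀
    lemma : ∀ u y x p → 1ℤ + y * u ≡ x * p → - y * u ≡ 1ℤ + - x * p
    lemma u y x p eq = begin
      - y * u              ≡⟨ ℤₚ.neg-distribˡ-* y u ⟨
      - (y * u)            ≡⟨ rearrange (y * u) ⟩
      1ℤ + - (1ℤ + y * u)  ≡⟨ cong (λ z → 1ℤ + - z) eq ⟩
      1ℤ + - (x * p)       ≡⟨ cong (λ z → 1ℤ + z) (ℤₚ.neg-distribˡ-* x p) ⟩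
      1ℤ + - x * p         ∎
      where open ≡-Reasoning
  ... | Bézout.-+ x y eq = + y , quotient (+ x)
    (trans (sym (ℤₚ.pos-* y u)) (trans (cong +_ (sym eq)) (cong (λ z → 1ℤ + z) (ℤₚ.pos-* x p))))

-- (1 + T)ᵖ ≡ 1 + Tᵖ for T the shift by d, since the hypothesis says that F n = (1 + T)ⁿ (F 0).
module Frobenius {q : ℕ} (pr : Prime (suc q)) where
  open Mod (suc q)

  private
    p = suc q

  module _ (F : ℕ → ℤ → ℤ) (d : ℤ) (pascal : ∀ n k → F (suc n) k ≋ F n k + F n (k - d)) where

    -- Each induction step moves one unit from `e` to `n` and removes it there by the hypothesis
    -- `pascal`; therefore `n` has to vary.
    binomial-expansion : ∀ e n k → F (n ℕ.+ e) k ≋ Σ< (suc e) (λ u → + (e C u) * F n (k - + u * d))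
    binomial-expansion zero n k = ≡⇒≋ (trans (cong₂ F (ℕₚ.+-identityʳ n) (lemma₀ k d)) (lemma₁ (F n (k - 0ℤ * d))))
      where
      lemma₀ : ∀ k d → k ≡ k - 0ℤ * d
      lemma₀ = solve-∀
      lemma₁ : ∀ x → x ≡ 0ℤ + 1ℤ * x
      lemma₁ = solve-∀
    binomial-expansion (suc e) n k = begin
      F (n ℕ.+ suc e) k
        ≡⟨ cong (λ x → F x k) (ℕₚ.+-suc n e) ⟩
      F (suc n ℕ.+ e) k
        ≈⟨ binomial-expansion e (suc n) k ⟩
      Σ< (suc e) (λ u → + (e C u) * F (suc n) (k - + u * d))
        ≈⟨ Σ<-≋ (suc e) (λ u _ → *-congˡ (+ (e C u)) (step u)) ⟩
      Σ< (suc e) (λ u → + (e C u) * (F n (k - + u * d) + F n (k - + suc u * d)))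
        ≡⟨ Σ<-pascal e (λ u → F n (k - + u * d)) ⟨
      Σ< (2 ℕ.+ e) (λ u → + (suc e C u) * F n (k - + u * d)) ∎
      where
      open ≋-Reasoning
      shift : ∀ k u d → k - u * d - d ≡ k - (1ℤ + u) * d
      shift = solve-∀
      step : ∀ u → F (suc n) (k - + u * d) ≋ F n (k - + u * d) + F n (k - + suc u * d)
      step u = ≋-trans (pascal n (k - + u * d))
        (≡⇒≋ (cong (λ x → F n (k - + u * d) + F n x) (shift k (+ u) d)))

    frobenius : ∀ n k → F (n ℕ.+ p) k ≋ F n k + F n (k - + p * d)
    frobenius n k = begin
      F (n ℕ.+ p) k
        ≈⟨ binomial-expansion p n k ⟩
      Σ< p (λ u → + (p C u) * F n (k - + u * d)) + + (p C p) * F n (k - + p * d)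
        ≡⟨ cong₂ _+_ (Σ<-head q (λ u → + (p C u) * F n (k - + u * d))) (cong (λ x → + x * F n (k - + p * d)) (nCn≡1 p)) ⟩
      1ℤ * F n (k - 0ℤ * d) + Σ< q (λ u → + (p C suc u) * F n (k - + suc u * d)) + 1ℤ * F n (k - + p * d)
        ≈⟨ +-cong (+-cong (≋-refl {1ℤ * F n (k - 0ℤ * d)}) (≋-trans (Σ<-≋ q (λ u u<q → *-congʳ (F n (k - + suc u * d)) (∣⇒≋0 (prime∣C pr u<q))))
                                          (≡⇒≋ (Σ<-zero q (λ _ _ → refl)))))
                  (≋-refl {1ℤ * F n (k - + p * d)}) ⟩
      1ℤ * F n (k - 0ℤ * d) + 0ℤ + 1ℤ * F n (k - + p * d)
        ≡⟨ cong (λ x → 1ℤ * F n x + 0ℤ + 1ℤ * F n (k - + p * d)) (drop k d) ⟩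
      1ℤ * F n k + 0ℤ + 1ℤ * F n (k - + p * d)
        ≡⟨ tidy (F n k) (F n (k - + p * d)) ⟩
      F n k + F n (k - + p * d) ∎
      where
      open ≋-Reasoning
      drop : ∀ k d → k - 0ℤ * d ≡ k
      drop = solve-∀
      tidy : ∀ x y → 1ℤ * x + 0ℤ + 1ℤ * y ≡ x + y
      tidy = solve-∀

  binom-+p : ∀ n k → binom (n ℕ.+ p) k ≋ binom n k + binom n (k - + p)
  binom-+p n k = ≋-trans (frobenius binom 1ℤ (λ n k → ≡⇒≋ (binom-pascal n k)) n k)
    (≡⇒≋ (cong (λ x → binom n k + binom n (k - x)) (ℤₚ.*-identityʳ (+ p))))

  -- `frobenius` a second time, for a ↦ C(n + ap, k) with shift p: `binom-+p` is exactly the Pascal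
  -- rule that it asks for.
  binom-+p² : ∀ n k → binom (n ℕ.+ p ℕ.* p) k ≋ binom n k + binom n (k - + p * + p)
  binom-+p² n k = ≋-trans (frobenius (λ a → binom (n ℕ.+ a ℕ.* p)) (+ p) step 0 k)
    (≡⇒≋ (cong (λ x → binom x k + binom x (k - + p * + p)) (ℕₚ.+-identityʳ n)))
    where
    step : ∀ a k → binom (n ℕ.+ suc a ℕ.* p) k ≋ binom (n ℕ.+ a ℕ.* p) k + binom (n ℕ.+ a ℕ.* p) (k - + p)
    step a k = ≋-trans (≡⇒≋ (cong (λ x → binom x k) (reassoc n (a ℕ.* p) p))) (binom-+p (n ℕ.+ a ℕ.* p) k)
      where
      reassoc : ∀ n ap p → n ℕ.+ (p ℕ.+ ap) ≡ n ℕ.+ ap ℕ.+ p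
      reassoc = ℕ-solve-∀

  -- `h` says k < p², so removing p² from the upper index leaves only an extra term with negative
  -- lower index.
  binom-+z*p² : ∀ z n k a → k + + suc a ≡ + p * + p → binom (n ℕ.+ z ℕ.* (p ℕ.* p)) k ≋ binom n k
  binom-+z*p² zero n k a h = ≡⇒≋ (cong (λ x → binom x k) (ℕₚ.+-identityʳ n))
  binom-+z*p² (suc z) n k a h = begin
    binom (n ℕ.+ (p² ℕ.+ z ℕ.* p²)) k            ≡⟨ cong (λ x → binom x k) (reassoc n (z ℕ.* p²) p²) ⟩
    binom (N ℕ.+ p²) k                           ≈⟨ binom-+p² N k ⟩
    binom N k + binom N (k - + p * + p)          ≡⟨ cong (λ x → binom N k + x) (binom-neg N (k - + p * + p) a below) ⟩
    binom N k + 0ℤ                               ≡⟨ ℤₚ.+-identityʳ (binom N k) ⟩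
    binom N k                                    ≈⟨ binom-+z*p² z n k a h ⟩
    binom n k                                    ∎
    where
    open ≋-Reasoning
    p² = p ℕ.* p
    N = n ℕ.+ z ℕ.* p²
    reassoc : ∀ n zp p → n ℕ.+ (p ℕ.+ zp) ≡ n ℕ.+ zp ℕ.+ p
    reassoc = ℕ-solve-∀
    move : ∀ k x a → k - x + a ≡ k + a - x
    move = solve-∀
    below : k - + p * + p + + suc a ≡ 0ℤ
    below = trans (move k (+ p * + p) (+ suc a)) (trans (cong (_- + p * + p) h) (ℤₚ.+-inverseʳ (+ p * + p)))

-- Sums along an arithmetic progression of difference p - 1

module Key {q : ℕ} (pr : Prime (suc q)) where
  open Mod (suc q)
  open Frobenius pr

  private
    p = suc q

    reassoc : ∀ N c q → suc (N ℕ.+ (q ℕ.+ c ℕ.* q)) ≡ N ℕ.+ c ℕ.* q ℕ.+ suc q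
    reassoc = ℕ-solve-∀

  -- The two sides of the key congruence, with the terms k = 0 included. The upper index `n` is free
  -- because the recurrences mix different upper indices; `v` is an integer because they may lower
  -- it below 0.
  sparse local-sum : ℕ → ℕ → ℤ → (ℕ → ℤ) → ℤ
  sparse    c n v g = Σ< (suc c) (λ k → g k * binom n (v + + k * + q))
  local-sum c n v g = Σ< (suc c) (λ k → + (c C k) * (g k * binom n (v - + k)))

  -- Split C(K+p, ·) by `binom-+p`. As p = q + 1, the index v + kq - p equals v - 1 + (k-1)q, so the
  -- second half carries g(k+1) = g(k) + Δg(k), and Pascal's rule merges the g(k) parts into upper
  -- index K+1. Two end terms drop out: `hN` (N < v + q) puts one above the upper index, `hv` (v ≤
  -- q) gives the other a negative lower index.
  sparse-suc : ∀ c N v g a w → v + + q ≡ + suc N + + a → v + + w ≡ + q →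
    sparse (suc c) (N ℕ.+ c ℕ.* q ℕ.+ p) v g
      ≋ sparse c (suc N ℕ.+ c ℕ.* q) v g + sparse c (N ℕ.+ c ℕ.* q) (v - 1ℤ) (Δ g)
  sparse-suc c N v g a w hN hv = begin
    Σ< (2 ℕ.+ c) (λ k → g k * binom (K ℕ.+ p) (v + + k * + q))
      ≈⟨ Σ<-≋ (2 ℕ.+ c) (λ k _ → ≋-trans (*-congˡ (g k) (binom-+p K (v + + k * + q)))
                                 (≡⇒≋ (ℤₚ.*-distribˡ-+ (g k) (A k) (B k)))) ⟩
    Σ< (2 ℕ.+ c) (λ k → g k * A k + g k * B k)
      ≡⟨ Σ<-+ (2 ℕ.+ c) (λ k → g k * A k) (λ k → g k * B k) ⟩
    S + g (suc c) * A (suc c) + Σ< (2 ℕ.+ c) (λ k → g k * B k)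
      ≡⟨ cong₂ _+_ (cong (λ x → S + g (suc c) * x) (binom-big K (v + + suc c * + q) a top))
                   (Σ<-head (suc c) (λ k → g k * B k)) ⟩
    S + g (suc c) * 0ℤ + (g 0 * B 0 + Σ< (suc c) (λ k → g (suc k) * B (suc k)))
      ≡⟨ cong₂ (λ x y → S + g (suc c) * 0ℤ + (g 0 * x + y)) (binom-neg K (v + 0ℤ * + q - + p) w bottom)
           (Σ<-cong (suc c) (λ k _ → cong (λ x → g (suc k) * binom K x) (shift v (+ k) (+ q)))) ⟩
    S + g (suc c) * 0ℤ + (g 0 * 0ℤ + S′)
      ≡⟨ drop-zeros S (g (suc c)) (g 0) S′ ⟩
    S + S′
      ≡⟨ Σ<-+ (suc c) (λ k → g k * A k) (λ k → g (suc k) * D k) ⟨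
    Σ< (suc c) (λ k → g k * A k + g (suc k) * D k)
      ≡⟨ Σ<-cong (suc c) (λ k _ → regroup k) ⟨
    Σ< (suc c) (λ k → g k * binom (suc K) (v + + k * + q) + Δ g k * D k)
      ≡⟨ Σ<-+ (suc c) (λ k → g k * binom (suc K) (v + + k * + q)) (λ k → Δ g k * D k) ⟩
    sparse c (suc K) v g + sparse c K (v - 1ℤ) (Δ g) ∎
    where
    open ≋-Reasoning
    K = N ℕ.+ c ℕ.* q
    A B D : ℕ → ℤ
    A k = binom K (v + + k * + q)
    B k = binom K (v + + k * + q - + p)
    D k = binom K (v - 1ℤ + + k * + q)
    S S′ : ℤ
    S  = Σ< (suc c) (λ k → g k * A k)
    S′ = Σ< (suc c) (λ k → g (suc k) * D k)
    drop-zeros : ∀ s x y t → s + x * 0ℤ + (y * 0ℤ + t) ≡ s + t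
    drop-zeros = solve-∀
    shift : ∀ v k q → v + (1ℤ + k) * q - (1ℤ + q) ≡ v - 1ℤ + k * q
    shift = solve-∀
    swap : ∀ v k q → v + k * q - 1ℤ ≡ v - 1ℤ + k * q
    swap = solve-∀
    combine : ∀ g g′ x y → g * (x + y) + (g′ - g) * y ≡ g * x + g′ * y
    combine = solve-∀
    regroup : ∀ k → g k * binom (suc K) (v + + k * + q) + Δ g k * D k ≡ g k * A k + g (suc k) * D k
    regroup k = trans
      (cong (λ x → g k * x + Δ g k * D k)
        (trans (binom-pascal K (v + + k * + q)) (cong (λ x → A k + binom K x) (swap v (+ k) (+ q)))))
      (combine (g k) (g (suc k)) (A k) (D k))
    bottom : v + 0ℤ * + q - + p + + suc w ≡ 0ℤ
    bottom = trans (rearrange v (+ q) (+ w)) (trans (cong (_- + q) hv) (ℤₚ.+-inverseʳ (+ q)))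
      where
      rearrange : ∀ v q w → v + 0ℤ * q - (1ℤ + q) + (1ℤ + w) ≡ v + w - q
      rearrange = solve-∀
    top : v + + suc c * + q ≡ + K + + suc a
    top = trans (lhs v (+ c) (+ q))
         (trans (cong (_+ + c * + q) hN)
         (trans (rhs (+ N) (+ a) (+ c * + q)) (cong (λ x → + N + x + + suc a) (sym (ℤₚ.pos-* c q)))))
      where
      lhs : ∀ v c q → v + (1ℤ + c) * q ≡ v + q + c * q
      lhs = solve-∀
      rhs : ∀ N a x → 1ℤ + N + a + x ≡ N + x + (1ℤ + a)
      rhs = solve-∀

  local-sum-suc : ∀ c K v g w → v + + w ≡ + q →
    local-sum (suc c) (K ℕ.+ p) v g ≋ local-sum c (suc K) v g + local-sum c K (v - 1ℤ) (Δ g)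
  local-sum-suc c K v g w hv = begin
    Σ< (2 ℕ.+ c) (λ k → + (suc c C k) * (g k * binom (K ℕ.+ p) (v - + k)))
      ≡⟨ Σ<-pascal c (λ k → g k * binom (K ℕ.+ p) (v - + k)) ⟩
    Σ< (suc c) (λ k → + (c C k) * (g k * binom (K ℕ.+ p) (v - + k) + g (suc k) * binom (K ℕ.+ p) (v - + suc k)))
      ≈⟨ Σ<-≋ (suc c) (λ k _ → *-congˡ (+ (c C k)) (+-cong (*-congˡ (g k) (low k)) (*-congˡ (g (suc k)) (low (suc k))))) ⟩
    Σ< (suc c) (λ k → + (c C k) * (g k * A k + g (suc k) * A (suc k)))
      ≡⟨ Σ<-cong (suc c) (λ k _ → regroup k) ⟨
    Σ< (suc c) (λ k → + (c C k) * (g k * binom (suc K) (v - + k)) + + (c C k) * (Δ g k * binom K (v - 1ℤ - + k)))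
      ≡⟨ Σ<-+ (suc c) (λ k → + (c C k) * (g k * binom (suc K) (v - + k)))
                      (λ k → + (c C k) * (Δ g k * binom K (v - 1ℤ - + k))) ⟩
    local-sum c (suc K) v g + local-sum c K (v - 1ℤ) (Δ g) ∎
    where
    open ≋-Reasoning
    A : ℕ → ℤ
    A k = binom K (v - + k)
    below : ∀ k → v - + k - + p + + suc (k ℕ.+ w) ≡ 0ℤ
    below k = trans (rearrange v (+ k) (+ q) (+ w)) (trans (cong (_- + q) hv) (ℤₚ.+-inverseʳ (+ q)))
      where
      rearrange : ∀ v k q w → v - k - (1ℤ + q) + (1ℤ + (k + w)) ≡ v + w - q
      rearrange = solve-∀
    low : ∀ k → binom (K ℕ.+ p) (v - + k) ≋ A k
    low k = ≋-trans (binom-+p K (v - + k))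
      (≡⇒≋ (trans (cong (λ x → A k + x) (binom-neg K (v - + k - + p) (k ℕ.+ w) (below k))) (ℤₚ.+-identityʳ (A k))))
    shift₁ : ∀ v k → v - k - 1ℤ ≡ v - (1ℤ + k)
    shift₁ = solve-∀
    shift₂ : ∀ v k → v - 1ℤ - k ≡ v - (1ℤ + k)
    shift₂ = solve-∀
    combine : ∀ c g g′ x y → c * (g * (x + y)) + c * ((g′ - g) * y) ≡ c * (g * x + g′ * y)
    combine = solve-∀
    regroup : ∀ k → + (c C k) * (g k * binom (suc K) (v - + k)) + + (c C k) * (Δ g k * binom K (v - 1ℤ - + k))
                      ≡ + (c C k) * (g k * A k + g (suc k) * A (suc k))
    regroup k = trans
      (cong₂ (λ x y → + (c C k) * (g k * x) + + (c C k) * (Δ g k * y))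
        (trans (binom-pascal K (v - + k)) (cong (λ x → A k + binom K x) (shift₁ v (+ k))))
        (cong (binom K) (shift₂ v (+ k))))
      (combine (+ (c C k)) (g k) (g (suc k)) (A k) (A (suc k)))

  -- Induction along the common recurrence. `N` is both the degree bound (deg g < N) and the
  -- remainder in the upper index N + cq: it stays with `g`, or drops by one together with the
  -- degree and `v`. At N = 0 the function is zero; at c = 0 both sums are the single term k = 0.
  sparse≋local : ∀ c N v g a w → (∀ n → Δ^ N g n ≡ 0ℤ) → v + + q ≡ + N + + a → v + + w ≡ + q →
    sparse c (N ℕ.+ c ℕ.* q) v g ≋ local-sum c (N ℕ.+ c ℕ.* q) v g
  sparse≋local c zero v g a w hg hN hv = ≡⇒≋ (trans
    (Σ<-zero (suc c) (λ k _ → cong (_* binom (c ℕ.* q) (v + + k * + q)) (hg k)))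
    (sym (Σ<-zero (suc c) (λ k _ → trans (cong (λ x → + (c C k) * (x * binom (c ℕ.* q) (v - + k))) (hg k))
                                         (ℤₚ.*-zeroʳ (+ (c C k)))))))
  sparse≋local zero N@(suc _) v g a w hg hN hv = ≡⇒≋ (lemma (g 0 * binom (N ℕ.+ 0) (v + 0ℤ)))
    where
    lemma : ∀ x → 0ℤ + x ≡ 0ℤ + 1ℤ * x
    lemma = solve-∀
  sparse≋local (suc c) (suc N) v g a w hg hN hv rewrite reassoc N c q = begin
    sparse (suc c) (K ℕ.+ p) v g
      ≈⟨ sparse-suc c N v g a w hN hv ⟩
    sparse c (suc K) v g + sparse c K (v - 1ℤ) (Δ g)
      ≈⟨ +-cong (sparse≋local c (suc N) v g a w hg hN hv)
                (sparse≋local c N (v - 1ℤ) (Δ g) a (suc w) hg hN′ (trans (shift v (+ w)) hv)) ⟩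
    local-sum c (suc K) v g + local-sum c K (v - 1ℤ) (Δ g)
      ≈⟨ local-sum-suc c K v g w hv ⟨
    local-sum (suc c) (K ℕ.+ p) v g ∎
    where
    open ≋-Reasoning
    K = N ℕ.+ c ℕ.* q
    shift : ∀ v w → v - 1ℤ + (1ℤ + w) ≡ v + w
    shift = solve-∀
    lhs : ∀ v q → v - 1ℤ + q ≡ v + q - 1ℤ
    lhs = solve-∀
    rhs : ∀ N a → 1ℤ + N + a - 1ℤ ≡ N + a
    rhs = solve-∀
    hN′ : v - 1ℤ + + q ≡ + N + + a
    hN′ = trans (lhs v (+ q)) (trans (cong (_- 1ℤ) hN) (rhs (+ N) (+ a)))

-- Lagrange interpolation and the matrix α

-- `sparse≋local` ties the order of the vanishing difference to the remainder N, which may exceed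
-- m+1.
Δ^-vanish : ∀ a N g → (∀ n → Δ^ N g n ≡ 0ℤ) → ∀ n → Δ^ (a ℕ.+ N) g n ≡ 0ℤ
Δ^-vanish zero    N g h n = h n
Δ^-vanish (suc a) N g h n = trans (Δ^-suc (a ℕ.+ N) g n)
  (cong₂ _-_ (Δ^-vanish a N g h (suc n)) (Δ^-vanish a N g h n))

neg1^-+ : ∀ m n → neg1^ (m ℕ.+ n) ≡ neg1^ m * neg1^ n
neg1^-+ zero    n = sym (ℤₚ.*-identityˡ (neg1^ n))
neg1^-+ (suc m) n = trans (cong -_ (neg1^-+ m n)) (ℤₚ.neg-distribˡ-* (neg1^ m) (neg1^ n))

-- A Kronecker delta at n = m+1-i, in additive form to avoid truncated subtraction.
node : ℕ → ℕ → ℕ → ℤ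
node m i n = if does (n ℕ.+ i ℕ.≟ suc m) then 1ℤ else 0ℤ

-- In the variable n = c - j, the α(i,l) are the sums of C(r-l, b-m+j(p-1)) against the
-- polynomial of degree ≤ m in n that is 1 at m+1-i and 0 at the other points of [0,m].
-- Beyond m its values are, up to sign, the β(n-m,i).
lagrange : ℕ → ℕ → ℕ → ℤ
lagrange m i n = if does (n ℕ.≤? m) then node m i n else neg1^ (suc i) * β m i (n ∸ m)

node-yes : ∀ m i n → n ℕ.+ i ≡ suc m → node m i n ≡ 1ℤ
node-yes m i n h = cong (if_then 1ℤ else 0ℤ) (dec-true (n ℕ.+ i ℕ.≟ suc m) h)

node-no : ∀ m i n → n ℕ.+ i ≢ suc m → node m i n ≡ 0ℤ
node-no m i n h = cong (if_then 1ℤ else 0ℤ) (dec-false (n ℕ.+ i ℕ.≟ suc m) h)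

lagrange-low : ∀ m i n → n ≤ m → lagrange m i n ≡ node m i n
lagrange-low m i n n≤m =
  cong (if_then node m i n else neg1^ (suc i) * β m i (n ∸ m)) (dec-true (n ℕ.≤? m) n≤m)

lagrange-high : ∀ m i k → lagrange m i (suc m ℕ.+ k) ≡ neg1^ (suc i) * β m i (suc k)
lagrange-high m i k = trans
  (cong (if_then node m i (suc m ℕ.+ k) else neg1^ (suc i) * β m i (suc m ℕ.+ k ∸ m))
        (dec-false (suc m ℕ.+ k ℕ.≤? m) (ℕₚ.<⇒≱ (s≤s (ℕₚ.m≤m+n m k)))))
  (cong (λ x → neg1^ (suc i) * β m i x) (trans (cong (_∸ m) (sym (ℕₚ.+-suc m k))) (ℕₚ.m+n∸m≡n m (suc k))))

-- Reversing the summation index turns the sum in the recursion into part of a convolution with the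
-- coefficients of (1 - x)ᵐ⁺¹.
βS≡ : ∀ m i n k → βS m i n k ≡ - Σ< k (λ l → altBinom (suc m) (n ∸ l) * β m i (suc l))
βS≡ m i n zero    = refl
βS≡ m i n (suc k) = trans
  (cong (_+ neg1^ (suc (n ∸ k)) * + (suc m C (n ∸ k)) * β m i (suc k)) (βS≡ m i n k))
  (lemma (Σ< k (λ l → altBinom (suc m) (n ∸ l) * β m i (suc l))) (neg1^ (n ∸ k)) (+ (suc m C (n ∸ k))) (β m i (suc k)))
  where
  lemma : ∀ x s c b → - x + - s * c * b ≡ - (x + s * c * b)
  lemma = solve-∀

-- The recursion of β, read as the coefficient of xⁿ in (1 - x)ᵐ⁺¹ Σₖ β(k+1,i) xᵏ: the term k = n is
-- β(n+1,i) itself, and the other terms cancel its `βS` part.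
β-convolution : ∀ m i n →
  Σ< (suc n) (λ k → altBinom (suc m) (n ∸ k) * β m i (suc k)) ≡ neg1^ n * + (suc m C (i ℕ.+ n))
β-convolution m i n = begin
  S + altBinom (suc m) (n ∸ n) * (βS m i n n + t)
    ≡⟨ cong₂ (λ x y → S + altBinom (suc m) x * (y + t)) (ℕₚ.n∸n≡0 n) (βS≡ m i n n) ⟩
  S + 1ℤ * (- S + t)
    ≡⟨ lemma S t ⟩
  t ∎
  where
  open ≡-Reasoning
  S = Σ< n (λ k → altBinom (suc m) (n ∸ k) * β m i (suc k))
  t = neg1^ n * + (suc m C (i ℕ.+ n))
  lemma : ∀ s t → s + 1ℤ * (- s + t) ≡ t
  lemma = solve-∀

-- By `Δ^≡Δconv` the difference is a convolution. On [0,m] only the node `j` contributes, and the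
-- values beyond m contribute the opposite by `β-convolution`. Writing m = j + i makes the node of
-- row i+1 a variable.
Δ^-lagrange : ∀ j i n → Δ^ (suc (j ℕ.+ i)) (lagrange (j ℕ.+ i) (suc i)) n ≡ 0ℤ
Δ^-lagrange j i n = begin
  Δ^ (suc m) g n
    ≡⟨ Δ^≡Δconv (suc m) g n ⟩
  Σ< (suc (n ℕ.+ suc m)) (λ x → altBinom (suc m) (n ℕ.+ suc m ∸ x) * g x)
    ≡⟨ cong (λ y → Σ< y (λ x → altBinom (suc m) (n ℕ.+ suc m ∸ x) * g x)) (ℕₚ.+-comm (suc n) (suc m)) ⟩
  Σ< (suc m ℕ.+ suc n) (λ x → altBinom (suc m) (n ℕ.+ suc m ∸ x) * g x)
    ≡⟨ Σ<-split (suc m) (suc n) (λ x → altBinom (suc m) (n ℕ.+ suc m ∸ x) * g x) ⟩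
  Σ< (suc m) (λ x → altBinom (suc m) (n ℕ.+ suc m ∸ x) * g x)
    + Σ< (suc n) (λ k → altBinom (suc m) (n ℕ.+ suc m ∸ (suc m ℕ.+ k)) * g (suc m ℕ.+ k))
    ≡⟨ cong₂ _+_ low high ⟩
  neg1^ n * neg1^ (suc i) * + (suc m C (suc i ℕ.+ n)) + - neg1^ (suc i) * (neg1^ n * + (suc m C (suc i ℕ.+ n)))
    ≡⟨ cancel (neg1^ n) (neg1^ (suc i)) (+ (suc m C (suc i ℕ.+ n))) ⟩
  0ℤ ∎
  where
  open ≡-Reasoning
  m = j ℕ.+ i
  g = lagrange m (suc i)
  cancel : ∀ s t c → s * t * c + - t * (s * c) ≡ 0ℤ
  cancel = solve-∀
  swap : ∀ a s b → a * (s * b) ≡ s * (a * b)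
  swap = solve-∀
  node-at : ∀ x → x ≢ j → x ℕ.+ suc i ≢ suc m
  node-at x x≢j h = x≢j (ℕₚ.+-cancelʳ-≡ (suc i) x j (trans h (sym (ℕₚ.+-suc j i))))
  index : n ℕ.+ suc m ∸ j ≡ n ℕ.+ suc i
  index = trans (cong (_∸ j) (reorder n j i)) (ℕₚ.m+n∸m≡n j (n ℕ.+ suc i))
    where
    reorder : ∀ n j i → n ℕ.+ suc (j ℕ.+ i) ≡ j ℕ.+ (n ℕ.+ suc i)
    reorder = ℕ-solve-∀
  low : Σ< (suc m) (λ x → altBinom (suc m) (n ℕ.+ suc m ∸ x) * g x)
          ≡ neg1^ n * neg1^ (suc i) * + (suc m C (suc i ℕ.+ n))
  low = begin
    Σ< (suc m) (λ x → altBinom (suc m) (n ℕ.+ suc m ∸ x) * g x)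
      ≡⟨ Σ<-single (suc m) j (s≤s (ℕₚ.m≤m+n j i)) (λ x x<1+m x≢j →
           trans (cong (λ y → altBinom (suc m) (n ℕ.+ suc m ∸ x) * y)
                       (trans (lagrange-low m (suc i) x (ℕ.s≤s⁻¹ x<1+m)) (node-no m (suc i) x (node-at x x≢j))))
                 (ℤₚ.*-zeroʳ (altBinom (suc m) (n ℕ.+ suc m ∸ x)))) ⟩
    altBinom (suc m) (n ℕ.+ suc m ∸ j) * g j
      ≡⟨ cong₂ (λ x y → altBinom (suc m) x * y) index
           (trans (lagrange-low m (suc i) j (ℕₚ.m≤m+n j i)) (node-yes m (suc i) j (ℕₚ.+-suc j i))) ⟩
    altBinom (suc m) (n ℕ.+ suc i) * 1ℤ
      ≡⟨ ℤₚ.*-identityʳ (altBinom (suc m) (n ℕ.+ suc i)) ⟩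
    neg1^ (n ℕ.+ suc i) * + (suc m C (n ℕ.+ suc i))
      ≡⟨ cong₂ (λ x y → x * + (suc m C y)) (neg1^-+ n (suc i)) (ℕₚ.+-comm n (suc i)) ⟩
    neg1^ n * neg1^ (suc i) * + (suc m C (suc i ℕ.+ n)) ∎
  high : Σ< (suc n) (λ k → altBinom (suc m) (n ℕ.+ suc m ∸ (suc m ℕ.+ k)) * g (suc m ℕ.+ k))
           ≡ - neg1^ (suc i) * (neg1^ n * + (suc m C (suc i ℕ.+ n)))
  high = begin
    Σ< (suc n) (λ k → altBinom (suc m) (n ℕ.+ suc m ∸ (suc m ℕ.+ k)) * g (suc m ℕ.+ k))
      ≡⟨ Σ<-cong (suc n) (λ k _ → trans
           (cong₂ (λ x y → altBinom (suc m) x * y)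
              (trans (cong (_∸ (suc m ℕ.+ k)) (ℕₚ.+-comm n (suc m))) (ℕₚ.[m+n]∸[m+o]≡n∸o (suc m) n k))
              (lagrange-high m (suc i) k))
           (swap (altBinom (suc m) (n ∸ k)) (neg1^ (2 ℕ.+ i)) (β m (suc i) (suc k)))) ⟩
    Σ< (suc n) (λ k → neg1^ (2 ℕ.+ i) * (altBinom (suc m) (n ∸ k) * β m (suc i) (suc k)))
      ≡⟨ Σ<-*ˡ (suc n) (neg1^ (2 ℕ.+ i)) (λ k → altBinom (suc m) (n ∸ k) * β m (suc i) (suc k)) ⟩
    neg1^ (2 ℕ.+ i) * Σ< (suc n) (λ k → altBinom (suc m) (n ∸ k) * β m (suc i) (suc k))
      ≡⟨ cong (neg1^ (2 ℕ.+ i) *_) (β-convolution m (suc i) n) ⟩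
    neg1^ (2 ℕ.+ i) * (neg1^ n * + (suc m C (suc i ℕ.+ n))) ∎

module _ (q b c r e y n₀ j i l : ℕ) where

  private
    m = j ℕ.+ i
    M = n₀ ℕ.+ (m ℕ.+ y) ℕ.* q
    B : ℤ → ℤ
    B = binom (r ∸ l)

  -- The hypotheses give y = c - m - e and n₀ = b - m + eq, so M = s - m. The terms n > m of the sum
  -- make up α₁; for 1 ≤ n ≤ m only the node n = j survives, and it is the extra binomial
  -- coefficient of α.
  α-formula : ε₁ (suc q) b m ≡ e → c ≡ m ℕ.+ y ℕ.+ e → m ℕ.+ n₀ ≡ b ℕ.+ e ℕ.* q →
    α (suc q) b c r m (suc i) l ≡ Σ< (m ℕ.+ y) (λ n → lagrange m (suc i) (suc n) * B (+ M - + suc n * + q))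
  α-formula hε hc hb = begin
    α (suc q) b c r m (suc i) l
      ≡⟨ by-cases j refl ⟩
    Σ< m (λ n → lagrange m (suc i) (suc n) * B (+ M - + suc n * + q)) + α₁ (suc q) b c r m (suc i) l
      ≡⟨ cong (λ x → Σ< m (λ n → lagrange m (suc i) (suc n) * B (+ M - + suc n * + q)) + x) α₁-eq ⟩
    Σ< m (λ n → lagrange m (suc i) (suc n) * B (+ M - + suc n * + q))
      + Σ< y (λ a → lagrange m (suc i) (suc (m ℕ.+ a)) * B (+ M - + suc (m ℕ.+ a) * + q))
      ≡⟨ Σ<-split m y (λ n → lagrange m (suc i) (suc n) * B (+ M - + suc n * + q)) ⟨
    Σ< (m ℕ.+ y) (λ n → lagrange m (suc i) (suc n) * B (+ M - + suc n * + q)) ∎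
    where
    open ≡-Reasoning
    b≡ : + b ≡ + m + + n₀ - + e * + q
    b≡ = trans (lemma (+ b) (+ e * + q))
           (cong (_- + e * + q) (trans (cong (λ x → + b + x) (sym (ℤₚ.pos-* e q))) (cong +_ (sym hb))))
      where
      lemma : ∀ b x → b ≡ b + x - x
      lemma = solve-∀
    M≡ : + M ≡ + n₀ + (+ m + + y) * + q
    M≡ = cong (λ x → + n₀ + x) (ℤₚ.pos-* (m ℕ.+ y) q)
    α₁-index : ∀ a → (b ⊖' m) + ((c ⊖' m) - + suc a) * + q ≡ + M - + suc (m ℕ.+ a) * + q
    α₁-index a = trans
      (cong₂ (λ x z → x - + m + (z - + m - + suc a) * + q) b≡ (cong +_ hc))
      (trans (lemma (+ m) (+ y) (+ e) (+ n₀) (+ q) (+ a)) (cong (_- + suc (m ℕ.+ a) * + q) (sym M≡)))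
      where
      lemma : ∀ m y e n q a →
        m + n - e * q - m + (m + y + e - m - (1ℤ + a)) * q ≡ n + (m + y) * q - (1ℤ + (m + a)) * q
      lemma = solve-∀
    α-index : (b ⊖' m) + ((+ (suc i ℕ.+ c) - + m) - 1ℤ) * + q ≡ + M - + j * + q
    α-index = trans
      (cong₂ (λ x z → x - + m + (+ suc i + z - + m - 1ℤ) * + q) b≡ (cong +_ hc))
      (trans (lemma (+ j) (+ i) (+ y) (+ e) (+ n₀) (+ q)) (cong (_- + j * + q) (sym M≡)))
      where
      lemma : ∀ j i y e n q →
        j + i + n - e * q - (j + i) + (1ℤ + i + (j + i + y + e) - (j + i) - 1ℤ) * q ≡ n + (j + i + y) * q - j * q
      lemma = solve-∀
    length≡ : c ∸ m ∸ ε₁ (suc q) b m ≡ y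
    length≡ = begin
      c ∸ m ∸ ε₁ (suc q) b m       ≡⟨ cong₂ (λ x z → x ∸ m ∸ z) hc hε ⟩
      m ℕ.+ y ℕ.+ e ∸ m ∸ e        ≡⟨ cong (λ x → x ∸ m ∸ e) (ℕₚ.+-assoc m y e) ⟩
      m ℕ.+ (y ℕ.+ e) ∸ m ∸ e      ≡⟨ cong (_∸ e) (ℕₚ.m+n∸m≡n m (y ℕ.+ e)) ⟩
      y ℕ.+ e ∸ e                  ≡⟨ ℕₚ.m+n∸n≡m y e ⟩
      y                            ∎
    α₁-eq : α₁ (suc q) b c r m (suc i) l
              ≡ Σ< y (λ a → lagrange m (suc i) (suc (m ℕ.+ a)) * B (+ M - + suc (m ℕ.+ a) * + q))
    α₁-eq = begin
      s * Σ< (c ∸ m ∸ ε₁ (suc q) b m) (λ a → B ((b ⊖' m) + ((c ⊖' m) - + suc a) * + q) * β m (suc i) (suc a))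
        ≡⟨ cong (λ x → s * Σ< x (λ a → B ((b ⊖' m) + ((c ⊖' m) - + suc a) * + q) * β m (suc i) (suc a))) length≡ ⟩
      s * Σ< y (λ a → B ((b ⊖' m) + ((c ⊖' m) - + suc a) * + q) * β m (suc i) (suc a))
        ≡⟨ Σ<-*ˡ y s (λ a → B ((b ⊖' m) + ((c ⊖' m) - + suc a) * + q) * β m (suc i) (suc a)) ⟨
      Σ< y (λ a → s * (B ((b ⊖' m) + ((c ⊖' m) - + suc a) * + q) * β m (suc i) (suc a)))
        ≡⟨ Σ<-cong y (λ a _ → trans (swap s (B ((b ⊖' m) + ((c ⊖' m) - + suc a) * + q)) (β m (suc i) (suc a)))
             (cong₂ _*_ (sym (lagrange-high m (suc i) a)) (cong B (α₁-index a)))) ⟩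
      Σ< y (λ a → lagrange m (suc i) (suc (m ℕ.+ a)) * B (+ M - + suc (m ℕ.+ a) * + q)) ∎
      where
      s = neg1^ (2 ℕ.+ i)
      swap : ∀ s b x → s * (b * x) ≡ s * x * b
      swap = solve-∀
    other : ∀ n → n < m → suc n ≢ j → lagrange m (suc i) (suc n) * B (+ M - + suc n * + q) ≡ 0ℤ
    other n n<m 1+n≢j = cong (_* B (+ M - + suc n * + q))
      (trans (lagrange-low m (suc i) (suc n) n<m)
             (node-no m (suc i) (suc n) (λ h → 1+n≢j (ℕₚ.+-cancelʳ-≡ (suc i) (suc n) j (trans h (sym (ℕₚ.+-suc j i)))))))
    -- Row m+1 is the case j = 0: its node n = 0 lies outside the sum, in accordance with the
    -- missing extra summand of α.
    by-cases : ∀ j′ → j′ ≡ j → α (suc q) b c r m (suc i) l ≡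
      Σ< m (λ n → lagrange m (suc i) (suc n) * B (+ M - + suc n * + q)) + α₁ (suc q) b c r m (suc i) l
    by-cases zero refl = begin
      α (suc q) b c r m (suc i) l
        ≡⟨ cong (if_then α₁ (suc q) b c r m (suc i) l + B ((b ⊖' m) + ((+ (suc i ℕ.+ c) - + m) - 1ℤ) * + q)
                 else α₁ (suc q) b c r m (suc i) l) (dec-false (suc i ℕ.≤? m) ℕₚ.1+n≰n) ⟩
      α₁ (suc q) b c r m (suc i) l
        ≡⟨ ℤₚ.+-identityˡ (α₁ (suc q) b c r m (suc i) l) ⟨
      0ℤ + α₁ (suc q) b c r m (suc i) l
        ≡⟨ cong (_+ α₁ (suc q) b c r m (suc i) l) (Σ<-zero m (λ n n<m → other n n<m (λ ()))) ⟨
      Σ< m (λ n → lagrange m (suc i) (suc n) * B (+ M - + suc n * + q)) + α₁ (suc q) b c r m (suc i) l ∎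
    by-cases (suc k) refl = begin
      α (suc q) b c r m (suc i) l
        ≡⟨ cong (if_then α₁ (suc q) b c r m (suc i) l + B ((b ⊖' m) + ((+ (suc i ℕ.+ c) - + m) - 1ℤ) * + q)
                 else α₁ (suc q) b c r m (suc i) l) (dec-true (suc i ℕ.≤? m) (s≤s (ℕₚ.m≤n+m i k))) ⟩
      α₁ (suc q) b c r m (suc i) l + B ((b ⊖' m) + ((+ (suc i ℕ.+ c) - + m) - 1ℤ) * + q)
        ≡⟨ ℤₚ.+-comm (α₁ (suc q) b c r m (suc i) l) _ ⟩
      B ((b ⊖' m) + ((+ (suc i ℕ.+ c) - + m) - 1ℤ) * + q) + α₁ (suc q) b c r m (suc i) l
        ≡⟨ cong (λ x → B x + α₁ (suc q) b c r m (suc i) l) α-index ⟩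
      B (+ M - + suc k * + q) + α₁ (suc q) b c r m (suc i) l
        ≡⟨ cong (_+ α₁ (suc q) b c r m (suc i) l) term ⟨
      Σ< m (λ n → lagrange m (suc i) (suc n) * B (+ M - + suc n * + q)) + α₁ (suc q) b c r m (suc i) l ∎
      where
      term : Σ< m (λ n → lagrange m (suc i) (suc n) * B (+ M - + suc n * + q)) ≡ B (+ M - + suc k * + q)
      term = trans (Σ<-single m k (s≤s (ℕₚ.m≤m+n k i)) (λ n n<m n≢k → other n n<m (λ h → n≢k (ℕₚ.suc-injective h))))
        (trans (cong (_* B (+ M - + suc k * + q))
                     (trans (lagrange-low m (suc i) (suc k) (s≤s (ℕₚ.m≤m+n k i)))
                            (node-yes m (suc i) (suc k) (ℕₚ.+-suc (suc k) i))))
               (ℤₚ.*-identityˡ (B (+ M - + suc k * + q))))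

α-lagrange : ∀ q b c r e m y n₀ i l → i ≤ m →
  ε₁ (suc q) b m ≡ e → c ≡ m ℕ.+ y ℕ.+ e → m ℕ.+ n₀ ≡ b ℕ.+ e ℕ.* q →
  α (suc q) b c r m (suc i) l
    ≡ Σ< (m ℕ.+ y) (λ n → lagrange m (suc i) (suc n) * binom (r ∸ l) (+ (n₀ ℕ.+ (m ℕ.+ y) ℕ.* q) - + suc n * + q))
α-lagrange q b c r e m y n₀ i l i≤m = subst
  (λ m → ε₁ (suc q) b m ≡ e → c ≡ m ℕ.+ y ℕ.+ e → m ℕ.+ n₀ ≡ b ℕ.+ e ℕ.* q →
    α (suc q) b c r m (suc i) l
      ≡ Σ< (m ℕ.+ y) (λ n → lagrange m (suc i) (suc n) * binom (r ∸ l) (+ (n₀ ℕ.+ (m ℕ.+ y) ℕ.* q) - + suc n * + q)))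
  (ℕₚ.m∸n+n≡m i≤m) (α-formula q b c r e y n₀ (m ∸ i) i l)

-- Column spaces modulo p

ΣFin-cong : ∀ n {f g : Fin n → ℤ} → (∀ i → f i ≡ g i) → ΣFin n f ≡ ΣFin n g
ΣFin-cong zero    h = refl
ΣFin-cong (suc n) h = cong₂ _+_ (h F.zero) (ΣFin-cong n (λ i → h (F.suc i)))

ΣFin-linear : ∀ n a b (f g : Fin n → ℤ) → ΣFin n (λ i → a * f i + b * g i) ≡ a * ΣFin n f + b * ΣFin n g
ΣFin-linear zero    a b f g = lemma a b
  where
  lemma : ∀ a b → 0ℤ ≡ a * 0ℤ + b * 0ℤ
  lemma = solve-∀
ΣFin-linear (suc n) a b f g = trans
  (cong (λ x → a * f F.zero + b * g F.zero + x) (ΣFin-linear n a b (λ i → f (F.suc i)) (λ i → g (F.suc i))))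
  (lemma a b (f F.zero) (g F.zero) (ΣFin n (λ i → f (F.suc i))) (ΣFin n (λ i → g (F.suc i))))
  where
  lemma : ∀ a b x y s t → a * x + b * y + (a * s + b * t) ≡ a * (x + s) + b * (y + t)
  lemma = solve-∀

kronecker : ∀ {n} → Fin n → Fin n → ℤ
kronecker F.zero    F.zero    = 1ℤ
kronecker F.zero    (F.suc j) = 0ℤ
kronecker (F.suc i) F.zero    = 0ℤ
kronecker (F.suc i) (F.suc j) = kronecker i j

ΣFin-zero : ∀ n {f : Fin n → ℤ} → (∀ i → f i ≡ 0ℤ) → ΣFin n f ≡ 0ℤ
ΣFin-zero zero    h = refl
ΣFin-zero (suc n) h = cong₂ _+_ (h F.zero) (ΣFin-zero n (λ i → h (F.suc i)))

ΣFin-kronecker : ∀ n (l : Fin n) f → ΣFin n (λ i → f i * kronecker l i) ≡ f l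
ΣFin-kronecker (suc n) F.zero f = trans
  (cong₂ _+_ (ℤₚ.*-identityʳ (f F.zero)) (ΣFin-zero n (λ i → ℤₚ.*-zeroʳ (f (F.suc i)))))
  (ℤₚ.+-identityʳ (f F.zero))
ΣFin-kronecker (suc n) (F.suc l) f = trans
  (cong₂ _+_ (ℤₚ.*-zeroʳ (f F.zero)) (ΣFin-kronecker n l (λ i → f (F.suc i))))
  (ℤₚ.+-identityˡ (f (F.suc l)))

module Span (p : ℕ) {k n : ℕ} (A : Fin k → Fin n → ℤ) where
  open Mod p

  InSpan : (Fin k → ℤ) → Set
  InSpan w = ∃ λ (X : Fin n → ℤ) → ∀ j → ΣFin n (λ l → A j l * X l) ≋ w j

  span-≋ : ∀ {u w} → (∀ j → u j ≋ w j) → InSpan u → InSpan w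
  span-≋ h (X , eq) = X , λ j → ≋-trans (eq j) (h j)

  span-column : ∀ l → InSpan (λ j → A j l)
  span-column l = kronecker l , λ j → ≡⇒≋ (ΣFin-kronecker n l (A j))

  span-linear : ∀ a b {u w} → InSpan u → InSpan w → InSpan (λ j → a * u j + b * w j)
  span-linear a b {u} {w} (X , X-eq) (Y , Y-eq) = (λ l → a * X l + b * Y l) , λ j → begin
    ΣFin n (λ l → A j l * (a * X l + b * Y l))
      ≡⟨ ΣFin-cong n (λ l → distribute (A j l) a (X l) b (Y l)) ⟩
    ΣFin n (λ l → a * (A j l * X l) + b * (A j l * Y l))
      ≡⟨ ΣFin-linear n a b (λ l → A j l * X l) (λ l → A j l * Y l) ⟩
    a * ΣFin n (λ l → A j l * X l) + b * ΣFin n (λ l → A j l * Y l)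
      ≈⟨ +-cong (*-congˡ a (X-eq j)) (*-congˡ b (Y-eq j)) ⟩
    a * u j + b * w j ∎
    where
    open ≋-Reasoning
    distribute : ∀ z a x b y → z * (a * x + b * y) ≡ a * (z * x) + b * (z * y)
    distribute = solve-∀

  span-zero : InSpan (λ _ → 0ℤ)
  span-zero = (λ _ → 0ℤ) , λ j → ≡⇒≋ (ΣFin-zero n (λ l → ℤₚ.*-zeroʳ (A j l)))

  span-Σ< : ∀ v (a : ℕ → ℤ) (G : Fin k → ℕ → ℤ) → (∀ x → x < v → InSpan (λ j → G j x)) →
    InSpan (λ j → Σ< v (λ x → a x * G j x))
  span-Σ< zero    a G h = span-zero
  span-Σ< (suc v) a G h = span-≋ (λ j → ≡⇒≋ (cong (_+ a v * G j v) (ℤₚ.*-identityˡ (Σ< v (λ x → a x * G j x)))))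
    (span-linear 1ℤ (a v) (span-Σ< v a G (λ x x<v → h x (ℕₚ.m<n⇒m<1+n x<v))) (h v ℕₚ.≤-refl))

-- The triangular system for the values g(1), ..., g(m)

module Triangular {q : ℕ} (pr : Prime (suc q)) (m y a₀ w₀ a z : ℕ)
  (q≡  : q ≡ a₀ ℕ.+ suc m ℕ.+ w₀)
  (c<p : m ℕ.+ y ≤ q)
  (p²≡ : suc q ℕ.* suc q ≡ a₀ ℕ.+ suc m ℕ.+ (m ℕ.+ y) ℕ.* q ℕ.+ suc a)
  (g   : Fin (suc m) → ℕ → ℤ)
  (deg : ∀ j n → Δ^ (suc m) (g j) n ≡ 0ℤ)
  where

  private
    -- Here `c` is the c - ε₁ of the theorem, `M` is s - m, and m < N ≤ q by `q≡`. The index `r`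
    -- exceeds m + M by a multiple of p², and `p²≡` says M < p².
    p c N M r : ℕ
    p = suc q
    c = m ℕ.+ y
    N = a₀ ℕ.+ suc m
    M = N ℕ.+ c ℕ.* q
    r = m ℕ.+ (M ℕ.+ z ℕ.* (p ℕ.* p))

  open Mod (suc q)
  open Frobenius pr
  open Key pr

  matrix : Fin (suc m) → Fin (suc m) → ℤ
  matrix j l = Σ< c (λ n → g j (suc n) * binom (r ∸ toℕ l) (+ M - + suc n * + q))

  open Span (suc q) matrix

  -- Pascal's rule backwards: subtracting the vector for l+1 from the one for l lowers the upper and
  -- the lower index by one. The columns l to l+v enter, hence the bound l + v ≤ m.
  span-shift : ∀ v l → l ℕ.+ v ≤ m →
    InSpan (λ j → Σ< c (λ n → g j (suc n) * binom (r ∸ (l ℕ.+ v)) (+ M - + suc n * + q - + v)))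
  span-shift zero l l≤m = span-≋
    (λ j → ≡⇒≋ (Σ<-cong c (λ n _ → cong₂ (λ x k → g j (suc n) * binom (r ∸ x) k)
      (trans (Fₚ.toℕ-fromℕ< (s≤s (subst (_≤ m) (ℕₚ.+-identityʳ l) l≤m))) (sym (ℕₚ.+-identityʳ l)))
      (sym (ℤₚ.+-identityʳ (+ M - + suc n * + q))))))
    (span-column (fromℕ< (s≤s (subst (_≤ m) (ℕₚ.+-identityʳ l) l≤m))))
  span-shift (suc v) l l+1+v≤m = span-≋
    (λ j → ≡⇒≋ (trans (sym (combine j)) (Σ<-cong c (λ n _ → step j n))))
    (span-linear 1ℤ (- 1ℤ)
      (span-shift v l (ℕₚ.≤-trans (ℕₚ.+-monoʳ-≤ l (ℕₚ.n≤1+n v)) l+1+v≤m))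
      (span-shift v (suc l) (subst (_≤ m) (ℕₚ.+-suc l v) l+1+v≤m)))
    where
    K = r ∸ (l ℕ.+ suc v)
    x : ℕ → ℤ
    x n = + M - + suc n * + q - + v
    U W : Fin (suc m) → ℕ → ℤ
    U j n = g j (suc n) * binom (r ∸ (l ℕ.+ v)) (x n)
    W j n = g j (suc n) * binom (r ∸ (suc l ℕ.+ v)) (x n)
    combine : ∀ j → Σ< c (λ n → 1ℤ * U j n + - 1ℤ * W j n) ≡ 1ℤ * Σ< c (U j) + - 1ℤ * Σ< c (W j)
    combine j = trans (Σ<-+ c (λ n → 1ℤ * U j n) (λ n → - 1ℤ * W j n))
      (cong₂ _+_ (Σ<-*ˡ c 1ℤ (U j)) (Σ<-*ˡ c (- 1ℤ) (W j)))
    upper : r ∸ (l ℕ.+ v) ≡ suc K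
    upper = trans (cong (suc r ∸_) (sym (ℕₚ.+-suc l v)))
      (ℕₚ.+-∸-assoc 1 (ℕₚ.≤-trans l+1+v≤m (ℕₚ.m≤m+n m (M ℕ.+ z ℕ.* (p ℕ.* p)))))
    difference : ∀ g s t → 1ℤ * (g * (s + t)) + - 1ℤ * (g * s) ≡ g * t
    difference = solve-∀
    shift : ∀ k v → k - v - 1ℤ ≡ k - (1ℤ + v)
    shift = solve-∀
    step : ∀ j n → 1ℤ * U j n + - 1ℤ * W j n ≡ g j (suc n) * binom K (+ M - + suc n * + q - + suc v)
    step j n = begin
      1ℤ * U j n + - 1ℤ * W j n
        ≡⟨ cong₂ (λ s t → 1ℤ * (g j (suc n) * s) + - 1ℤ * (g j (suc n) * binom (r ∸ t) (x n)))
             (trans (cong (λ y → binom y (x n)) upper) (binom-pascal K (x n))) (sym (ℕₚ.+-suc l v)) ⟩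
      1ℤ * (g j (suc n) * (binom K (x n) + binom K (x n - 1ℤ))) + - 1ℤ * (g j (suc n) * binom K (x n))
        ≡⟨ difference (g j (suc n)) (binom K (x n)) (binom K (x n - 1ℤ)) ⟩
      g j (suc n) * binom K (x n - 1ℤ)
        ≡⟨ cong (λ k → g j (suc n) * binom K k) (shift (+ M - + suc n * + q) (+ v)) ⟩
      g j (suc n) * binom K (+ M - + suc n * + q - + suc v) ∎
      where open ≡-Reasoning

  -- The choice l = m - v makes the upper index r - m = M + zp² for every v. The multiple of p² is
  -- removed because the lower index is below p², and symmetry turns M - v - nq into v + nq.
  span-sparse : ∀ v → v ≤ m → InSpan (λ j → Σ< c (λ n → g j (suc n) * binom M (+ v + + suc n * + q)))
  span-sparse v v≤m = span-≋ (λ j → Σ<-≋ c (λ n _ → *-congˡ (g j (suc n)) (reduce n)))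
    (span-shift v (m ∸ v) (ℕₚ.≤-reflexive (ℕₚ.m∸n+n≡m v≤m)))
    where
    open ≋-Reasoning
    upper : r ∸ (m ∸ v ℕ.+ v) ≡ M ℕ.+ z ℕ.* (p ℕ.* p)
    upper = trans (cong (r ∸_) (ℕₚ.m∸n+n≡m v≤m)) (ℕₚ.m+n∸m≡n m (M ℕ.+ z ℕ.* (p ℕ.* p)))
    index : ∀ M x v → M - x - v ≡ M - (v + x)
    index = solve-∀
    bound : ∀ n → + M - + suc n * + q - + v + + suc (a ℕ.+ (suc n ℕ.* q ℕ.+ v)) ≡ + p * + p
    bound n = trans (cong (λ y → + M - + suc n * + q - + v + (+ suc a + (y + + v))) (ℤₚ.pos-* (suc n) q))
      (trans (cancel (+ M) (+ suc n * + q) (+ v) (+ suc a)) (trans (cong +_ (sym p²≡)) (ℤₚ.pos-* p p)))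
      where
      cancel : ∀ M x v a → M - x - v + (a + (x + v)) ≡ M + a
      cancel = solve-∀
    reduce : ∀ n → binom (r ∸ (m ∸ v ℕ.+ v)) (+ M - + suc n * + q - + v) ≋ binom M (+ v + + suc n * + q)
    reduce n = begin
      binom (r ∸ (m ∸ v ℕ.+ v)) (+ M - + suc n * + q - + v)
        ≡⟨ cong (λ x → binom x (+ M - + suc n * + q - + v)) upper ⟩
      binom (M ℕ.+ z ℕ.* (p ℕ.* p)) (+ M - + suc n * + q - + v)
        ≈⟨ binom-+z*p² z M (+ M - + suc n * + q - + v) (a ℕ.+ (suc n ℕ.* q ℕ.+ v)) (bound n) ⟩
      binom M (+ M - + suc n * + q - + v)
        ≡⟨ cong (binom M) (index (+ M) (+ suc n * + q) (+ v)) ⟩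
      binom M (+ M - (+ v + + suc n * + q))
        ≡⟨ binom-sym M (+ v + + suc n * + q) ⟩
      binom M (+ v + + suc n * + q) ∎

  coefficient : ℕ → ℕ → ℤ
  coefficient v n = + (c C suc n) * binom M (+ v - + suc n)

  -- `sparse≋local` at v+1: the terms n = 0 of both sides are g(0) C(M,v+1) and cancel. On the right
  -- C(M,v+1-n) is 0 for n > v+1 and 1 for n = v+1, which gives the triangular shape.
  sparse≋triangular : ∀ v → suc v ≤ m → ∀ j →
    Σ< c (λ n → g j (suc n) * binom M (+ suc v + + suc n * + q))
      ≋ Σ< v (λ n → coefficient (suc v) n * g j (suc n)) + + (c C suc v) * g j (suc v)
  sparse≋triangular v v<m j = ≋-trans (+-cancelˡ (g j 0 * binom M (+ suc v)) heads) (≡⇒≋ tail)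
    where
    S = Σ< c (λ n → g j (suc n) * binom M (+ suc v + + suc n * + q))
    L = Σ< c (λ n → + (c C suc n) * (g j (suc n) * binom M (+ suc v - + suc n)))
    w rest : ℕ
    w = m ∸ suc v
    rest = w ℕ.+ y
    c≡ : c ≡ suc v ℕ.+ rest
    c≡ = trans (cong (ℕ._+ y) (sym (ℕₚ.m+[n∸m]≡n v<m))) (ℕₚ.+-assoc (suc v) w y)
    upper : + suc v + + q ≡ + N + + (suc v ℕ.+ w₀)
    upper = trans (cong (λ x → + (suc v ℕ.+ x)) q≡) (cong +_ (reorder (suc v) N w₀))
      where
      reorder : ∀ v N w → v ℕ.+ (N ℕ.+ w) ≡ N ℕ.+ (v ℕ.+ w)
      reorder = ℕ-solve-∀
    lower : + suc v + + (w ℕ.+ (suc a₀ ℕ.+ w₀)) ≡ + q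
    lower = cong +_ (trans (sym (ℕₚ.+-assoc (suc v) w (suc a₀ ℕ.+ w₀)))
      (trans (cong (ℕ._+ (suc a₀ ℕ.+ w₀)) (ℕₚ.m+[n∸m]≡n v<m)) (trans (reorder m a₀ w₀) (sym q≡))))
      where
      reorder : ∀ m a w → m ℕ.+ (suc a ℕ.+ w) ≡ a ℕ.+ suc m ℕ.+ w
      reorder = ℕ-solve-∀
    heads : g j 0 * binom M (+ suc v) + S ≋ g j 0 * binom M (+ suc v) + L
    heads = begin
      g j 0 * binom M (+ suc v) + S
        ≡⟨ cong (λ x → g j 0 * binom M x + S) (sym (ℤₚ.+-identityʳ (+ suc v))) ⟩
      g j 0 * binom M (+ suc v + 0ℤ) + S
        ≡⟨ Σ<-head c (λ n → g j n * binom M (+ suc v + + n * + q)) ⟨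
      sparse c M (+ suc v) (g j)
        ≈⟨ sparse≋local c N (+ suc v) (g j) (suc v ℕ.+ w₀) (w ℕ.+ (suc a₀ ℕ.+ w₀))
             (Δ^-vanish a₀ (suc m) (g j) (deg j)) upper lower ⟩
      local-sum c M (+ suc v) (g j)
        ≡⟨ Σ<-head c (λ n → + (c C n) * (g j n * binom M (+ suc v - + n))) ⟩
      1ℤ * (g j 0 * binom M (+ suc v + 0ℤ)) + L
        ≡⟨ cong (_+ L) (trans (ℤₚ.*-identityˡ (g j 0 * binom M (+ suc v + 0ℤ)))
                              (cong (λ x → g j 0 * binom M x) (ℤₚ.+-identityʳ (+ suc v)))) ⟩
      g j 0 * binom M (+ suc v) + L ∎
      where open ≋-Reasoning
    T : ℕ → ℤ
    T n = + (c C suc n) * (g j (suc n) * binom M (+ suc v - + suc n))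
    beyond : ∀ n → T (suc v ℕ.+ n) ≡ 0ℤ
    beyond n = trans (cong (λ x → + (c C (2 ℕ.+ v ℕ.+ n)) * (g j (2 ℕ.+ v ℕ.+ n) * x))
                       (binom-neg M (+ suc v - + (2 ℕ.+ v ℕ.+ n)) n (below (+ v) (+ n))))
                     (zeros (+ (c C (2 ℕ.+ v ℕ.+ n))) (g j (2 ℕ.+ v ℕ.+ n)))
      where
      below : ∀ v n → 1ℤ + v - (1ℤ + 1ℤ + v + n) + (1ℤ + n) ≡ 0ℤ
      below = solve-∀
      zeros : ∀ a b → a * (b * 0ℤ) ≡ 0ℤ
      zeros = solve-∀
    diagonal : T v ≡ + (c C suc v) * g j (suc v)
    diagonal = trans (cong (λ x → + (c C suc v) * (g j (suc v) * binom M x)) (ℤₚ.+-inverseʳ (+ suc v)))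
                     (cong (+ (c C suc v) *_) (ℤₚ.*-identityʳ (g j (suc v))))
    swap : ∀ a b x → a * (b * x) ≡ a * x * b
    swap = solve-∀
    tail : L ≡ Σ< v (λ n → coefficient (suc v) n * g j (suc n)) + + (c C suc v) * g j (suc v)
    tail = begin
      Σ< c T
        ≡⟨ cong (λ x → Σ< x T) c≡ ⟩
      Σ< (suc v ℕ.+ rest) T
        ≡⟨ Σ<-split (suc v) rest T ⟩
      Σ< v T + T v + Σ< rest (λ n → T (suc v ℕ.+ n))
        ≡⟨ cong (λ x → Σ< v T + T v + x) (Σ<-zero rest (λ n _ → beyond n)) ⟩
      Σ< v T + T v + 0ℤ
        ≡⟨ ℤₚ.+-identityʳ (Σ< v T + T v) ⟩
      Σ< v T + T v
        ≡⟨ cong₂ _+_ (Σ<-cong v (λ n _ → swap (+ (c C suc n)) (g j (suc n)) (binom M (+ suc v - + suc n)))) diagonal ⟩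
      Σ< v (λ n → coefficient (suc v) n * g j (suc n)) + + (c C suc v) * g j (suc v) ∎
      where open ≡-Reasoning

  -- Forward substitution; the diagonal entry C(c,v+1) is invertible because v+1 ≤ m ≤ c < p.
  span-next : ∀ v → suc v ≤ m → (∀ n → n < v → InSpan (λ j → g j (suc n))) → InSpan (λ j → g j (suc v))
  span-next v v<m previous
    with inverse pr (prime∤C c (suc v) pr (s≤s c<p) (ℕₚ.≤-trans v<m (ℕₚ.m≤m+n m y)))
  ... | d , d*u≋1 = span-≋ solve-for
    (span-linear d (- d) (span-sparse (suc v) v<m) (span-Σ< v (coefficient (suc v)) (λ j n → g j (suc n)) previous))
    where
    open ≋-Reasoning
    u = + (c C suc v)
    isolate : ∀ d s u x → d * (s + u * x) + - d * s ≡ d * u * x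
    isolate = solve-∀
    solve-for : ∀ j → d * Σ< c (λ n → g j (suc n) * binom M (+ suc v + + suc n * + q))
                        + - d * Σ< v (λ n → coefficient (suc v) n * g j (suc n)) ≋ g j (suc v)
    solve-for j = begin
      d * Σ< c (λ n → g j (suc n) * binom M (+ suc v + + suc n * + q)) + - d * s
        ≈⟨ +-cong (*-congˡ d (sparse≋triangular v v<m j)) (≋-refl { - d * s}) ⟩
      d * (s + u * g j (suc v)) + - d * s
        ≡⟨ isolate d s u (g j (suc v)) ⟩
      d * u * g j (suc v)
        ≈⟨ *-congʳ (g j (suc v)) d*u≋1 ⟩
      1ℤ * g j (suc v)
        ≡⟨ ℤₚ.*-identityˡ (g j (suc v)) ⟩
      g j (suc v) ∎
      where s = Σ< v (λ n → coefficient (suc v) n * g j (suc n))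

  span-below : ∀ v → v ≤ m → ∀ n → n < v → InSpan (λ j → g j (suc n))
  span-below (suc v) v<m n n<1+v with n ℕ.≟ v
  ... | yes refl = span-next v v<m (span-below v (ℕₚ.<⇒≤ v<m))
  ... | no n≢v   = span-below v (ℕₚ.<⇒≤ v<m) n (ℕₚ.≤∧≢⇒< (ℕ.s≤s⁻¹ n<1+v) n≢v)

  span-values : ∀ n → n < m → InSpan (λ j → g j (suc n))
  span-values = span-below m ℕₚ.≤-refl

-- From the column space to the unit vectors

-- Row i has its node at m+1-i, so evaluating all rows at that one point singles out row i.
node≡e : ∀ m i k (j : Fin (suc m)) → suc k ℕ.+ i ≡ suc m → node m (suc (toℕ j)) (suc k) ≡ e m i j
node≡e m i k j h with suc (toℕ j) ℕ.≟ i
... | yes refl = trans (node-yes m i (suc k) h) (sym (cong (if_then 1ℤ else 0ℤ) (dec-true (i ℕ.≟ i) refl)))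
... | no  ≢i   = trans
  (node-no m (suc (toℕ j)) (suc k) (λ h′ → ≢i (ℕₚ.+-cancelˡ-≡ (suc k) (suc (toℕ j)) i (trans h′ (sym h)))))
  (sym (cong (if_then 1ℤ else 0ℤ) (dec-false (suc (toℕ j) ℕ.≟ i) ≢i)))

-- The argument common to both values of ε₁, here `cut`: it needs n₀ = b - m + cut q to lie in
-- [m+1, q].
solvable : ∀ {q} → Prime (suc q) → ∀ b c t d m cut n₀ i →
  ε₁ (suc q) b m ≡ cut → m ℕ.+ n₀ ≡ b ℕ.+ cut ℕ.* q → suc m ≤ n₀ → n₀ ≤ q →
  m ℕ.+ cut ≤ c → c ≤ q → 2 ≤ t → 1 ≤ i → i ≤ m →
  ∃ λ (X : Fin (suc m) → ℤ) → (j : Fin (suc m)) →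
    + suc q ∣ (AX (suc q) b c (b ℕ.+ c ℕ.* q ℕ.+ suc q ^ t ℕ.* q ℕ.* d) m X j - e m i j)
solvable {q} pr b c (suc (suc t)) d m cut n₀ i hε hb m<n₀ n₀≤q m+cut≤c c≤q (s≤s (s≤s _)) 1≤i i≤m =
  proj₁ solution , λ j → ≋⇒∣ (AX-solution j)
  where
  p y a₀ w₀ x a z r : ℕ
  p = suc q
  y = c ∸ (m ℕ.+ cut)
  a₀ = n₀ ∸ suc m
  w₀ = q ∸ n₀
  x = q ∸ (m ℕ.+ y)
  -- Write p² = 1 + 2q + q² with q = n₀ + w₀ and q = (m+y) + x; subtracting M = n₀ + (m+y)q leaves 1
  -- + a.
  a = w₀ ℕ.+ q ℕ.+ x ℕ.* q
  -- The exponent of the theorem is 2 + t at this point; its first two factors p supply the p² next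
  -- to `z`.
  z = p ^ t ℕ.* q ℕ.* d
  r = b ℕ.+ c ℕ.* q ℕ.+ p ^ (2 ℕ.+ t) ℕ.* q ℕ.* d
  g : Fin (suc m) → ℕ → ℤ
  g j = lagrange m (suc (toℕ j))
  n₀≡ : n₀ ≡ a₀ ℕ.+ suc m
  n₀≡ = sym (ℕₚ.m∸n+n≡m m<n₀)
  q≡ : q ≡ a₀ ℕ.+ suc m ℕ.+ w₀
  q≡ = trans (sym (ℕₚ.m+[n∸m]≡n n₀≤q)) (cong (ℕ._+ w₀) n₀≡)
  c≡ : c ≡ m ℕ.+ y ℕ.+ cut
  c≡ = trans (sym (ℕₚ.m+[n∸m]≡n m+cut≤c)) (swap m cut y)
    where
    swap : ∀ m k y → m ℕ.+ k ℕ.+ y ≡ m ℕ.+ y ℕ.+ k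
    swap = ℕ-solve-∀
  c′≤q : m ℕ.+ y ≤ q
  c′≤q = ℕₚ.≤-trans (ℕₚ.m≤m+n (m ℕ.+ y) cut) (subst (_≤ q) c≡ c≤q)
  p²≡ : p ℕ.* p ≡ a₀ ℕ.+ suc m ℕ.+ (m ℕ.+ y) ℕ.* q ℕ.+ suc a
  p²≡ = trans (square q) (trans (cong₂ (λ s t → 1 ℕ.+ q ℕ.+ s ℕ.+ t ℕ.* q) q≡ (sym (ℕₚ.m+[n∸m]≡n c′≤q)))
          (regroup (a₀ ℕ.+ suc m) w₀ (m ℕ.+ y) x q))
    where
    square : ∀ q → suc q ℕ.* suc q ≡ 1 ℕ.+ q ℕ.+ q ℕ.+ q ℕ.* q
    square = ℕ-solve-∀
    regroup : ∀ n w c x q → 1 ℕ.+ q ℕ.+ (n ℕ.+ w) ℕ.+ (c ℕ.+ x) ℕ.* q ≡ n ℕ.+ c ℕ.* q ℕ.+ suc (w ℕ.+ q ℕ.+ x ℕ.* q)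
    regroup = ℕ-solve-∀
  deg : ∀ j n → Δ^ (suc m) (g j) n ≡ 0ℤ
  deg j n = subst (λ k → Δ^ (suc k) (lagrange k (suc (toℕ j))) n ≡ 0ℤ)
    (ℕₚ.m∸n+n≡m (Fₚ.toℕ≤pred[n] j)) (Δ^-lagrange (m ∸ toℕ j) (toℕ j) n)
  open Triangular pr m y a₀ w₀ a z q≡ c′≤q p²≡ g deg
  open Span (suc q) matrix
  open Mod (suc q)
  r≡ : r ≡ m ℕ.+ (a₀ ℕ.+ suc m ℕ.+ (m ℕ.+ y) ℕ.* q ℕ.+ z ℕ.* (p ℕ.* p))
  r≡ = trans (cong (λ s → b ℕ.+ s ℕ.* q ℕ.+ p ^ (2 ℕ.+ t) ℕ.* q ℕ.* d) c≡)
    (trans (collect b (m ℕ.+ y) cut q p (p ^ t) d)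
    (trans (cong (λ s → s ℕ.+ (m ℕ.+ y) ℕ.* q ℕ.+ z ℕ.* (p ℕ.* p)) (trans (sym hb) (cong (m ℕ.+_) n₀≡)))
      (reassoc m (a₀ ℕ.+ suc m) ((m ℕ.+ y) ℕ.* q) (z ℕ.* (p ℕ.* p)))))
    where
    collect : ∀ b c k q p s d →
      b ℕ.+ (c ℕ.+ k) ℕ.* q ℕ.+ p ℕ.* (p ℕ.* s) ℕ.* q ℕ.* d ≡ b ℕ.+ k ℕ.* q ℕ.+ c ℕ.* q ℕ.+ s ℕ.* q ℕ.* d ℕ.* (p ℕ.* p)
    collect = ℕ-solve-∀
    reassoc : ∀ m n x y → m ℕ.+ n ℕ.+ x ℕ.+ y ≡ m ℕ.+ (n ℕ.+ x ℕ.+ y)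
    reassoc = ℕ-solve-∀
  α≡matrix : ∀ j l → α p b c r m (suc (toℕ j)) (toℕ l) ≡ matrix j l
  α≡matrix j l = trans
    (cong (λ s → α p b c s m (suc (toℕ j)) (toℕ l)) r≡)
    (α-lagrange q b c (m ℕ.+ (a₀ ℕ.+ suc m ℕ.+ (m ℕ.+ y) ℕ.* q ℕ.+ z ℕ.* (p ℕ.* p))) cut m y (a₀ ℕ.+ suc m)
      (toℕ j) (toℕ l) (Fₚ.toℕ≤pred[n] j) hε c≡ (trans (cong (m ℕ.+_) (sym n₀≡)) hb))
  i+k≡m : m ∸ i ℕ.+ i ≡ m
  i+k≡m = ℕₚ.m∸n+n≡m i≤m
  solution : InSpan (λ j → g j (suc (m ∸ i)))
  -- The point n = m+1-i lies in [1,m] exactly when 1 ≤ i ≤ m.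
  solution = span-values (m ∸ i) (ℕₚ.∸-monoʳ-< 1≤i i≤m)
  AX-solution : ∀ j → AX p b c r m (proj₁ solution) j ≋ e m i j
  AX-solution j = begin
    AX p b c r m (proj₁ solution) j
      ≡⟨ ΣFin-cong (suc m) (λ l → cong (_* proj₁ solution l) (α≡matrix j l)) ⟩
    ΣFin (suc m) (λ l → matrix j l * proj₁ solution l)
      ≈⟨ proj₂ solution j ⟩
    lagrange m (suc (toℕ j)) (suc (m ∸ i))
      ≡⟨ lagrange-low m (suc (toℕ j)) (suc (m ∸ i)) (ℕₚ.∸-monoʳ-< 1≤i i≤m) ⟩
    node m (suc (toℕ j)) (suc (m ∸ i))
      ≡⟨ node≡e m i (m ∸ i) j (cong suc i+k≡m) ⟩
    e m i j ∎
    where open ≋-Reasoning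


-- The value of ε₁ and the four cases

ε₁-0 : ∀ p b m → 2 ℕ.* m ℕ.+ 1 ≤ b → ε₁ p b m ≡ 0
ε₁-0 p b m h = cong (if_then 0 else (if does (2 ℕ.* m ℕ.+ 1 ℕ.≤? b ℕ.+ (p ∸ 1)) then 1 else 2))
  (dec-true (2 ℕ.* m ℕ.+ 1 ℕ.≤? b) h)

ε₁-1 : ∀ p b m → b < 2 ℕ.* m ℕ.+ 1 → 2 ℕ.* m ℕ.+ 1 ≤ b ℕ.+ (p ∸ 1) → ε₁ p b m ≡ 1
ε₁-1 p b m h₀ h₁ = trans
  (cong (if_then 0 else (if does (2 ℕ.* m ℕ.+ 1 ℕ.≤? b ℕ.+ (p ∸ 1)) then 1 else 2))
    (dec-false (2 ℕ.* m ℕ.+ 1 ℕ.≤? b) (ℕₚ.<⇒≱ h₀)))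
  (cong (if_then 1 else 2) (dec-true (2 ℕ.* m ℕ.+ 1 ℕ.≤? b ℕ.+ (p ∸ 1)) h₁))

2m+1≡ : ∀ m → 2 ℕ.* m ℕ.+ 1 ≡ m ℕ.+ suc m
2m+1≡ = ℕ-solve-∀

module _ {q : ℕ} (b c m : ℕ) where

  -- On the left ε₁ = 0 and n₀ = b - m. On the right ε₁ = 1 and n₀ = b + q - m, where b ≤ m gives n₀
  -- ≤ q and 2m+2 ≤ p+b gives m < n₀.
  Regime : Set
  Regime = (2 ℕ.* m ℕ.+ 1 ≤ b × m ℕ.+ 1 ≤ c) ⊎ (b ≤ m × 2 ℕ.* m ℕ.+ 2 ≤ suc q ℕ.+ b × m ℕ.+ 2 ≤ c)

  -- In (1), m < c gives 2m+1 ≤ m+c ≤ b; (2) and the first half of (3) contain 2m+1 ≤ b. In the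
  -- second half of (3), m+2 ≤ c gives 2m+2 ≤ m+c ≤ p+b. In (4), p+b+1 ≤ m+c and c ≤ q force b ≤ m.
  regime : c ≤ q → m ℕ.+ 1 ℕ.+ ε (suc q) b c ≤ c →
    ((c ℕ.+ 1 ≤ b × m ℕ.+ c ≤ b)
     ⊎ (c ≤ b × 2 ℕ.* m ℕ.+ 1 ≤ b × b ℕ.+ 1 ≤ m ℕ.+ c)
     ⊎ (b ℕ.+ 1 ≤ c × (2 ℕ.* m ℕ.+ 1 ≤ b ⊎ (b ≤ m × m ℕ.+ 2 ≤ c)) × m ℕ.+ c ≤ suc q ℕ.+ b)
     ⊎ (b ℕ.+ 3 ℕ.+ suc q ≤ 2 ℕ.* c × suc q ℕ.+ b ℕ.+ 1 ≤ m ℕ.+ c × 2 ℕ.* m ℕ.+ 2 ≤ suc q ℕ.+ b × m ℕ.+ 3 ≤ c)) →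
    Regime
  regime c≤q hm cases with ℕₚ.m+n≤o⇒m≤o (m ℕ.+ 1) hm
  regime c≤q hm (inj₁ (_ , m+c≤b)) | m<c = inj₁ (ℕₚ.≤-trans 2m+1≤m+c m+c≤b , m<c)
    where
    2m+1≤m+c : 2 ℕ.* m ℕ.+ 1 ≤ m ℕ.+ c
    2m+1≤m+c = subst (_≤ m ℕ.+ c) (trans (cong (m ℕ.+_) (ℕₚ.+-comm m 1)) (sym (2m+1≡ m))) (ℕₚ.+-monoʳ-≤ m m<c)
  regime c≤q hm (inj₂ (inj₁ (_ , 2m<b , _))) | m<c = inj₁ (2m<b , m<c)
  regime c≤q hm (inj₂ (inj₂ (inj₁ (_ , inj₁ 2m<b , _)))) | m<c = inj₁ (2m<b , m<c)
  regime c≤q hm (inj₂ (inj₂ (inj₁ (_ , inj₂ (b≤m , m+2≤c) , m+c≤p+b)))) | _ =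
    inj₂ (b≤m , ℕₚ.≤-trans (subst (_≤ m ℕ.+ c) (double m) (ℕₚ.+-monoʳ-≤ m m+2≤c)) m+c≤p+b , m+2≤c)
    where
    double : ∀ m → m ℕ.+ (m ℕ.+ 2) ≡ 2 ℕ.* m ℕ.+ 2
    double = ℕ-solve-∀
  regime c≤q hm (inj₂ (inj₂ (inj₂ (_ , p+b<m+c , 2m+2≤p+b , m+3≤c)))) | _ =
    inj₂ (ℕₚ.+-cancelʳ-≤ c b m (ℕₚ.≤-trans b+c≤p+b+1 p+b<m+c) , 2m+2≤p+b
         , ℕₚ.≤-trans (ℕₚ.+-monoʳ-≤ m (ℕₚ.n≤1+n 2)) m+3≤c)
    where
    b+c≤p+b+1 : b ℕ.+ c ≤ suc q ℕ.+ b ℕ.+ 1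
    b+c≤p+b+1 = ℕₚ.≤-trans (ℕₚ.+-monoʳ-≤ b c≤q)
      (subst (b ℕ.+ q ≤_) (reorder b q) (ℕₚ.m≤m+n (b ℕ.+ q) 2))
      where
      reorder : ∀ b q → b ℕ.+ q ℕ.+ 2 ≡ suc q ℕ.+ b ℕ.+ 1
      reorder = ℕ-solve-∀

theorem8p1 : (p b c t d m : ℕ) → Prime p → 5 ≤ p →
    2 ≤ b → b ≤ p → 1 ≤ c → c ≤ p ∸ 1 →
    2 ≤ t → 1 ≤ d → ¬ (p ND.∣ d) →
    1 ≤ m → m ℕ.+ 1 ℕ.+ ε p b c ≤ c →
    ((c ℕ.+ 1 ≤ b × m ℕ.+ c ≤ b)
     ⊎ (c ≤ b × 2 ℕ.* m ℕ.+ 1 ≤ b × b ℕ.+ 1 ≤ m ℕ.+ c)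
     ⊎ (b ℕ.+ 1 ≤ c × (2 ℕ.* m ℕ.+ 1 ≤ b ⊎ (b ≤ m × m ℕ.+ 2 ≤ c)) × m ℕ.+ c ≤ p ℕ.+ b)
     ⊎ (b ℕ.+ 3 ℕ.+ p ≤ 2 ℕ.* c × p ℕ.+ b ℕ.+ 1 ≤ m ℕ.+ c × 2 ℕ.* m ℕ.+ 2 ≤ p ℕ.+ b × m ℕ.+ 3 ≤ c)) →
    let s = b ℕ.+ c ℕ.* (p ∸ 1)
        r = s ℕ.+ p ^ t ℕ.* (p ∸ 1) ℕ.* d
    in (i : ℕ) → 1 ≤ i → i ≤ m →
       ∃ λ (X : Fin (suc m) → ℤ) →
         (j : Fin (suc m)) → (+ p) ∣ (AX p b c r m X j - e m i j)
theorem8p1 (suc q) b c t d m pr _ _ b≤p _ c≤q 2≤t _ _ 1≤m hm cases i 1≤i i≤m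
  with regime b c m c≤q hm cases
... | inj₁ (2m<b , m<c) =
  solvable pr b c t d m 0 (b ∸ m) i (ε₁-0 (suc q) b m 2m<b) (trans (ℕₚ.m+[n∸m]≡n m≤b) (sym (ℕₚ.+-identityʳ b)))
    -- The upper bound n₀ = b - m ≤ p - 1 combines m ≥ 1 with b ≤ p.
    (ℕₚ.m+n≤o⇒m≤o∸n (suc m) (subst (_≤ b) (ℕₚ.+-comm m (suc m)) m+1+m≤b)) (ℕₚ.≤-trans (ℕₚ.∸-monoʳ-≤ b 1≤m) (ℕₚ.∸-monoˡ-≤ 1 b≤p))
    (subst (_≤ c) (sym (ℕₚ.+-identityʳ m)) (ℕₚ.m+n≤o⇒m≤o m m<c)) c≤q 2≤t 1≤i i≤m
  where
  m+1+m≤b : m ℕ.+ suc m ≤ b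
  m+1+m≤b = subst (_≤ b) (2m+1≡ m) 2m<b
  m≤b : m ≤ b
  m≤b = ℕₚ.m+n≤o⇒m≤o m m+1+m≤b
... | inj₂ (b≤m , 2m+2≤p+b , m+2≤c) =
  solvable pr b c t d m 1 (b ℕ.+ q ∸ m) i (ε₁-1 (suc q) b m b<2m+1 2m+1≤b+q)
    (trans (ℕₚ.m+[n∸m]≡n (ℕₚ.m+n≤o⇒m≤o m m+1+m≤b+q)) (cong (b ℕ.+_) (sym (ℕₚ.+-identityʳ q))))
    (ℕₚ.m+n≤o⇒m≤o∸n (suc m) (subst (_≤ b ℕ.+ q) (ℕₚ.+-comm m (suc m)) m+1+m≤b+q)) b+q∸m≤q
    (ℕₚ.≤-trans (ℕₚ.+-monoʳ-≤ m (ℕₚ.n≤1+n 1)) m+2≤c) c≤q 2≤t 1≤i i≤m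
  where
  m+1+m≤b+q : m ℕ.+ suc m ≤ b ℕ.+ q
  m+1+m≤b+q = ℕ.s≤s⁻¹ (subst₂ _≤_ (lhs m) (rhs q b) 2m+2≤p+b)
    where
    lhs : ∀ m → 2 ℕ.* m ℕ.+ 2 ≡ suc (m ℕ.+ suc m)
    lhs = ℕ-solve-∀
    rhs : ∀ q b → suc q ℕ.+ b ≡ suc (b ℕ.+ q)
    rhs = ℕ-solve-∀
  2m+1≤b+q : 2 ℕ.* m ℕ.+ 1 ≤ b ℕ.+ q
  2m+1≤b+q = subst (_≤ b ℕ.+ q) (sym (2m+1≡ m)) m+1+m≤b+q
  b<2m+1 : b < 2 ℕ.* m ℕ.+ 1
  b<2m+1 = subst (b <_) (sym (2m+1≡ m)) (ℕₚ.≤-trans (s≤s b≤m) (ℕₚ.m≤n+m (suc m) m))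
  b+q∸m≤q : b ℕ.+ q ∸ m ≤ q
  b+q∸m≤q = ℕₚ.≤-trans (ℕₚ.∸-monoʳ-≤ (b ℕ.+ q) b≤m) (ℕₚ.≤-reflexive (ℕₚ.m+n∸m≡n b q))
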